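{- The multiple-fragment heuristic for the traveling salesman problem on $n$ sites can be implemented in time $O(n^2)$. It can also be implemented in time $O(n^2\log^2 n)$ and space $O(n)$.
   Context: The input is a set of $n$ sites with a (symmetric) distance function $d$, not necessarily satisfying the triangle inequality; each site is stored in constant space, $d$ is evaluated in constant time, and two distances are compared in constant time. The multiple-fragment heuristic is the following: consider all edges (pairs of sites) one at a time in sorted order of length, and include an edge if it connects the endpoints of two different fragments of tours, where a fragment is a connected component (a path, possibly a single site) of the previously included edges. When only one fragment remains, its endpoints are joined to give a tour. Ties in the order may be broken arbitrarily. -}

module Defs where

open import Data.Bool using (if_then_else_)
open import Data.Fin using (Fin; toℕ; _<?_)
open import Data.List using (List; []; _∷_; map; filter; allFin; cartesianProduct)
open import Data.List.Membership.Propositional using (_∈_)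
open import Data.List.Relation.Binary.Permutation.Propositional using (_↭_)
import Data.List.Relation.Unary.Sorted.TotalOrder as SortedTotalOrder
open import Data.Nat as ℕ using (ℕ; suc; _+_; _*_; _∸_; _^_; _/_; _≤_; _<_; NonZero)
open import Data.Nat.DivMod using (_mod_)
open import Data.Product using (Σ-syntax; ∃-syntax; _×_; _,_; uncurry)
open import Data.Sum using (_⊎_)
open import Function using (_⇔_)
open import Function.Definitions using (Bijective)
open import Level using (_⊔_)
open import Relation.Binary using (DecTotalOrder)
open import Relation.Binary.Construct.Closure.ReflexiveTransitive using (Star)
open import Relation.Binary.PropositionalEquality using (_≡_)
open import Relation.Nullary using (¬_; does)

_∈O_ : (ℕ → ℕ) → (ℕ → ℕ) → Set
f ∈O g = ∃[ c ] ∃[ n₀ ] ∀ n → n₀ ≤ n → f n ≤ c * g n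

-- The values of the distance function are only ever compared, so they may come
-- from any decidable linear order.
record Distances (n : ℕ) c ℓ₁ ℓ₂ : Set (Level.suc (c ⊔ ℓ₁ ⊔ ℓ₂)) where
  field
    order : DecTotalOrder c ℓ₁ ℓ₂
  open DecTotalOrder order public
    using (totalOrder; _≈_; _≤?_) renaming (Carrier to Distance; _≤_ to _≼_)
  field
    d     : Fin n → Fin n → Distance
    d-sym : ∀ i j → d i j ≈ d j i

------------------------------------------------------------------------
-- The multiple-fragment heuristic

module _ {n : ℕ} where

  Edge : Set
  Edge = Fin n × Fin n

  Adj : List Edge → Fin n → Fin n → Set
  Adj F u v = (u , v) ∈ F ⊎ (v , u) ∈ F

  -- The fragments are the classes of this relation.
  SameFragment : List Edge → Fin n → Fin n → Set
  SameFragment F = Star (Adj F)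

  OneFragment : List Edge → Set
  OneFragment F = ∀ u v → SameFragment F u v

  -- Degree at most one: a single site is an endpoint of its own fragment.
  Endpoint : List Edge → Fin n → Set
  Endpoint F u = ∀ v w → Adj F u v → Adj F u w → v ≡ w

  Joins : Edge → List Edge → Set
  Joins (u , v) F = Endpoint F u × Endpoint F v × ¬ SameFragment F u v

  -- Scan es F G: considering the edges es in turn, with F already included,
  -- leads to the single fragment with edges G.
  data Scan : List Edge → List Edge → List Edge → Set where
    done    : ∀ {es F} → OneFragment F → Scan es F F
    include : ∀ {e es F G} → Joins e F → Scan es (e ∷ F) G → Scan (e ∷ es) F G
    discard : ∀ {e es F G} → ¬ Joins e F → Scan es F G → Scan (e ∷ es) F G

  -- A tour visits site tour 0, …, tour (n - 1) and then returns to tour 0.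
  TourEdge : .{{_ : NonZero n}} → (Fin n → Fin n) → Fin n → Fin n → Set
  TourEdge tour u v = ∃[ i ] tour i ≡ u × tour (suc (toℕ i) mod n) ≡ v

  -- The tour obtained from a single fragment by joining its endpoints u and v
  -- (which coincide when there is only one site).
  record Closes (F : List Edge) (tour : Fin n → Fin n) .{{_ : NonZero n}} : Set where
    field
      bijective : Bijective _≡_ _≡_ tour
      u v       : Fin n
      endpoints : ∀ w → Endpoint F w ⇔ (w ≡ u ⊎ w ≡ v)
      edges     : ∀ x y → (TourEdge tour x y ⊎ TourEdge tour y x) ⇔ Adj ((u , v) ∷ F) x y

allEdges : ∀ n → List (Fin n × Fin n)
allEdges n = filter (uncurry _<?_) (cartesianProduct (allFin n) (allFin n))

module _ {n : ℕ} {c ℓ₁ ℓ₂} (D : Distances n c ℓ₁ ℓ₂) where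
  open Distances D
  open SortedTotalOrder totalOrder using (Sorted)

  -- tour is a possible outcome of the heuristic, under some way of breaking ties.
  record MultipleFragment (tour : Fin n → Fin n) .{{_ : NonZero n}} : Set (c ⊔ ℓ₂) where
    field
      sequence : List (Edge {n})
      complete : sequence ↭ allEdges n
      sorted   : Sorted (map (uncurry d) sequence)
      included : List (Edge {n})
      scan     : Scan sequence [] included
      closes   : Closes included tour

------------------------------------------------------------------------
-- A unit-cost RAM with structured control flow

-- A cell holds either a machine word or a distance; sites are named by the
-- words 0, …, n - 1.
data Value {c} (A : Set c) : Set c where
  num : ℕ → Value A
  dst : A → Value A

infix 30 _[_≔_]
_[_≔_] : ∀ {a} {A : Set a} → (ℕ → A) → ℕ → A → ℕ → A
(f [ x ≔ a ]) y = if does (x ℕ.≟ y) then a else f y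

data Expr : Set where
  lit                         : ℕ → Expr
  reg                         : ℕ → Expr
  mem                         : Expr → Expr
  add monus times quotient le : Expr → Expr → Expr
  dist                        : Expr → Expr → Expr

infixr 5 _⨟_
infix  6 _:=_ mem[_]:=_

data Program : Set where
  skip       : Program
  _:=_       : ℕ → Expr → Program
  mem[_]:=_  : Expr → Expr → Program
  _⨟_        : Program → Program → Program
  ifElse     : Expr → Program → Program → Program
  while      : Expr → Program → Program

-- One unit for every operation performed.
cost : Expr → ℕ
cost (lit _)        = 1
cost (reg _)        = 1
cost (mem e)        = 1 + cost e
cost (add e f)      = 1 + cost e + cost f
cost (monus e f)    = 1 + cost e + cost f
cost (times e f)    = 1 + cost e + cost f
cost (quotient e f) = 1 + cost e + cost f
cost (le e f)       = 1 + cost e + cost f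
cost (dist e f)     = 1 + cost e + cost f

record State {c} (A : Set c) : Set c where
  constructor ⟪_,_⟫
  field
    registers : ℕ → Value A
    memory    : ℕ → Value A
open State public

-- Words are less than wordBound, and memory consists of the cells with address
-- less than space. Execution is stuck when either limit is exceeded, and on
-- operands of the wrong kind. The registers need no limit, since a program
-- mentions only a fixed number of them.
module Machine {n : ℕ} {c ℓ₁ ℓ₂} (D : Distances n c ℓ₁ ℓ₂) (wordBound space : ℕ) where
  open Distances D

  infix 4 _⊢_↦_ _,_⇓[_]_

  data _⊢_↦_ (s : State Distance) : Expr → Value Distance → Set c where
    lit      : ∀ {k} → k < wordBound → s ⊢ lit k ↦ num k
    reg      : ∀ {x} → s ⊢ reg x ↦ registers s x
    mem      : ∀ {e a} → s ⊢ e ↦ num a → a < space → s ⊢ mem e ↦ memory s a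
    add      : ∀ {e f a b} → s ⊢ e ↦ num a → s ⊢ f ↦ num b → a + b < wordBound →
               s ⊢ add e f ↦ num (a + b)
    monus    : ∀ {e f a b} → s ⊢ e ↦ num a → s ⊢ f ↦ num b →
               s ⊢ monus e f ↦ num (a ∸ b)
    times    : ∀ {e f a b} → s ⊢ e ↦ num a → s ⊢ f ↦ num b → a * b < wordBound →
               s ⊢ times e f ↦ num (a * b)
    quotient : ∀ {e f a b} → s ⊢ e ↦ num a → s ⊢ f ↦ num (suc b) →
               s ⊢ quotient e f ↦ num (a / suc b)
    le-num   : ∀ {e f a b} → s ⊢ e ↦ num a → s ⊢ f ↦ num b →
               s ⊢ le e f ↦ num (if does (a ℕ.≤? b) then 1 else 0)
    le-dst   : ∀ {e f a b} → s ⊢ e ↦ dst a → s ⊢ f ↦ dst b →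
               s ⊢ le e f ↦ num (if does (a ≤? b) then 1 else 0)
    dist     : ∀ {e f i j} → s ⊢ e ↦ num (toℕ i) → s ⊢ f ↦ num (toℕ j) →
               s ⊢ dist e f ↦ dst (d i j)

  -- p , s ⇓[ t ] s′: started in s, the program p halts in s′ after time t.
  data _,_⇓[_]_ : Program → State Distance → ℕ → State Distance → Set c where
    skip   : ∀ {s} → skip , s ⇓[ 1 ] s
    assign : ∀ {s x e v} → s ⊢ e ↦ v →
             x := e , s ⇓[ 1 + cost e ] ⟪ registers s [ x ≔ v ] , memory s ⟫
    store  : ∀ {s e f a v} → s ⊢ e ↦ num a → a < space → s ⊢ f ↦ v →
             mem[ e ]:= f , s ⇓[ 1 + cost e + cost f ] ⟪ registers s , memory s [ a ≔ v ] ⟫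
    seq    : ∀ {s s′ s″ p q t t′} → p , s ⇓[ t ] s′ → q , s′ ⇓[ t′ ] s″ →
             p ⨟ q , s ⇓[ t + t′ ] s″
    then   : ∀ {s s′ e p q t k} → s ⊢ e ↦ num (suc k) → p , s ⇓[ t ] s′ →
             ifElse e p q , s ⇓[ 1 + cost e + t ] s′
    else   : ∀ {s s′ e p q t} → s ⊢ e ↦ num 0 → q , s ⇓[ t ] s′ →
             ifElse e p q , s ⇓[ 1 + cost e + t ] s′
    stop   : ∀ {s e p} → s ⊢ e ↦ num 0 →
             while e p , s ⇓[ 1 + cost e ] s
    loop   : ∀ {s s′ s″ e p t t′ k} → s ⊢ e ↦ num (suc k) →
             p , s ⇓[ t ] s′ → while e p , s′ ⇓[ t′ ] s″ →
             while e p , s ⇓[ 1 + cost e + t + t′ ] s″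

  -- Register 0 holds the number of sites; everything else is zero.
  initial : State Distance
  initial = ⟪ (λ _ → num 0) [ 0 ≔ num n ] , (λ _ → num 0) ⟫

  Outputs : State Distance → (Fin n → Fin n) → Set c
  Outputs s tour = ∀ i → memory s (toℕ i) ≡ num (toℕ (tour i))

-- The one program p serves all numbers of sites and all distance functions,
-- within time T n and S n memory cells, on words of O(log n) bits.
ImplementsMultipleFragment : ∀ c ℓ₁ ℓ₂ → Program → (T S : ℕ → ℕ) →
                             Set (Level.suc (c ⊔ ℓ₁ ⊔ ℓ₂))
ImplementsMultipleFragment c ℓ₁ ℓ₂ p T S =
  ∃[ k ] ∀ n .{{_ : NonZero n}} (D : Distances n c ℓ₁ ℓ₂) →
    let open Distances D
        open Machine D ((2 + n) ^ k) (S n)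
    in Σ[ s ∈ State Distance ] ∃[ t ] ∃[ tour ]
         p , initial ⇓[ t ] s × t ≤ T n × Outputs s tour × MultipleFragment D tour

{-# OPTIONS --safe #-}
-- One program, a nearest-neighbour chain, serves both halves: it runs in time O(n²) within 6 n cells.
--
-- The valid edges are those that join endpoints of different fragments; they only ever cease to
-- be valid.  The program follows a chain of fragments, each leading to the next by a shortest
-- valid edge at it and each edge strictly shorter than the one before.  When no shorter edge is
-- found at the end of the chain, the last edge is a shortest valid one at both of its fragments;
-- these are merged and removed from the chain, the rest of which remains a chain.  A step takes
-- time O(n), and three times the number of fragments minus the length of the chain decreases in
-- every step.
--
-- The heuristic includes the same edges.  All edges within a fragment are no longer than the
-- valid edges at it, so when a merge makes an edge e invalid, it is already invalid on account of
-- the edges no longer than e.  Hence scanning the edges in sorted order, with ties broken in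
-- favour of those of the path, discards exactly the edges outside the path.
module Submission where

open import Defs
open import Data.Bool using (Bool; true; false; if_then_else_; _∧_)
open import Data.Fin as Fin using (Fin; zero; suc; toℕ; fromℕ<; combine)
open import Data.Fin.Properties as Fin using (_≟_; toℕ-injective; toℕ<n; toℕ-fromℕ<; toℕ-combine; combine-injective)
open import Data.Fin.Subset using (Subset; ∣_∣) renaming (_∈_ to _∈ₛ_)
open import Data.Fin.Subset.Properties using (p⊂q⇒∣p∣<∣q∣; ∣p∣≤n)
open import Data.List using (List; []; _∷_; allFin; cartesianProduct)
open import Data.List.Membership.Propositional using (_∈_)
open import Data.List.Membership.Propositional.Properties
  using (∈-filter⁺; ∈-filter⁻; ∈-cartesianProduct⁺; ∈-allFin)
open import Data.List.Relation.Binary.Permutation.Propositional using (↭-sym; ↭⇒↭ₛ)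
open import Data.List.Relation.Binary.Permutation.Propositional.Properties using (∈-resp-↭)
import Data.List.Relation.Binary.Permutation.Setoid.Properties as Permutationₛ
open import Data.List.Relation.Unary.All as All using (All; []; _∷_)
open import Data.List.Relation.Unary.AllPairs using (AllPairs; []; _∷_)
open import Data.List.Relation.Unary.Any using (here; there)
import Data.List.Relation.Unary.Linked as Linked
import Data.List.Relation.Unary.Linked.Properties as Linked
open import Data.List.Relation.Unary.Sorted.TotalOrder.Properties using (Sorted⇒AllPairs)
open import Data.List.Relation.Unary.Unique.Propositional using (Unique)
import Data.List.Relation.Unary.Unique.Propositional.Properties as Unique
import Data.List.Sort as Sort
open import Data.Nat as ℕ using (ℕ; zero; suc; _+_; _*_; _∸_; _^_; _≤_; _<_; s≤s; z≤n; NonZero)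
open import Data.Nat.DivMod using (_mod_; _%_; m<n⇒m%n≡m; n%n≡0; m%n<n)
open import Data.Nat.Logarithm using (⌊log₂_⌋; ⌊log₂⌋-mono-≤)
open import Data.Nat.Properties as ℕ hiding (_≟_; _≤?_)
open import Data.Product using (Σ-syntax; ∃-syntax; _×_; _,_; proj₁; proj₂; map₂; uncurry)
open import Data.Product.Properties using (≡-dec)
open import Data.Product.Relation.Binary.Lex.NonStrict using (×-decTotalOrder)
open import Data.Sum as Sum using (_⊎_; inj₁; inj₂)
open import Data.Vec using (Vec; []; _∷_; lookup; _[_]≔_; replicate; tabulate)
open import Data.Vec.Properties
  using (lookup∘update; lookup∘update′; lookup-replicate; lookup∘tabulate; []=⇒lookup; lookup⇒[]=)
open import Function using (_∘_; id; mk⇔)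
open import Level using (Level; _⊔_)
open import Relation.Binary using (DecTotalOrder; tri<; tri≈; tri>)
open import Relation.Binary.Construct.Closure.ReflexiveTransitive as Star using (Star; ε; _◅_; _◅◅_)
import Relation.Binary.Construct.On as On
open import Relation.Binary.PropositionalEquality
open import Relation.Nullary using (¬_; Dec; yes; no; does; contradiction)
open import Relation.Nullary.Decidable as Dec using (dec-true; dec-false; ¬?; _×-dec_; _⊎-dec_)

-- Listing the edges in sorted order would take quadratic space, so the program never sees that
-- order; it enters only into the proof, and only once the path is complete. Ties are the main
-- obstacle. A chain that grew along edges of equal length could return to a fragment it has left,
-- so it grows along strictly shorter ones only; and the sequence that the heuristic is said to
-- follow is chosen in hindsight, with the finished path at hand. A merge costs the chain up to two
-- edges, the merged one and the one leading up to it, whose far end may have become an interior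
-- site. Weighing a fragment by 3 pays for both of them and for the iteration itself. As the chain
-- has fewer than n edges, 4 n iterations suffice: 3 n for the fragments and n for the chain. Every
-- fragment is kept as a name and a pair of positions at each of its sites. Renumbering all sites at
-- a merge takes linear time, as does the search for a nearest edge, so neither linked lists nor a
-- union-find structure are called for.

-- Fragments as numbered paths: reversal and concatenation

module _ {n : ℕ} where

  adj-sym : ∀ {F : List (Edge {n})} {u v} → Adj F u v → Adj F v u
  adj-sym = Sum.swap

  adj-weaken : ∀ {e} {F : List (Edge {n})} {u v} → Adj F u v → Adj (e ∷ F) u v
  adj-weaken = Sum.map there there

  -- Where each site lies: a name for its fragment (one of the sites of the
  -- fragment), and the numbers of sites before and after it on the path.
  record Placement : Set where
    field
      frag         : Fin n → Fin n
      before after : Fin n → ℕ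
  open Placement

  Tip : Placement → Fin n → Set
  Tip P u = before P u ≡ 0 ⊎ after P u ≡ 0

  Valid : Placement → Fin n → Fin n → Set
  Valid P u v = Tip P u × Tip P v × frag P u ≢ frag P v

  -- Makes every fragment a path: `injective`, `size`, `pred` and `succ` number its sites 0, 1, ...
  -- without gaps, and `adj⇒` and `adj⇐` identify the edges with the pairs of consecutive numbers.
  -- The direction of the numbering remains free.
  record Layout (P : Placement) (F : List (Edge {n})) : Set where
    field
      frag-idem : ∀ u → frag P (frag P u) ≡ frag P u
      adj⇒      : ∀ {u v} → Adj F u v →
                  frag P u ≡ frag P v ×
                  (suc (before P u) ≡ before P v ⊎ suc (before P v) ≡ before P u)
      adj⇐      : ∀ {u v} → frag P u ≡ frag P v → suc (before P u) ≡ before P v → Adj F u v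
      connected : ∀ {u v} → frag P u ≡ frag P v → SameFragment F u v
      injective : ∀ {u v} → frag P u ≡ frag P v → before P u ≡ before P v → u ≡ v
      size      : ∀ {u v} → frag P u ≡ frag P v →
                  before P u + after P u ≡ before P v + after P v
      pred      : ∀ {u k} → before P u ≡ suc k → ∃[ v ] frag P v ≡ frag P u × before P v ≡ k
      succ      : ∀ {u k} → after P u ≡ suc k → ∃[ v ] frag P v ≡ frag P u × after P v ≡ k

  -- Needed because `join` attaches the first site of one fragment to the last of another, whereas a
  -- valid edge may touch either end of each.
  flip : Fin n → Placement → Placement
  flip c P = record
    { frag   = frag P
    ; before = λ u → if does (frag P u ≟ c) then after P u else before P u
    ; after  = λ u → if does (frag P u ≟ c) then before P u else after P u
    }

  private
    -- With equal totals, a step up in the first summand is a step down in the second; this is how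
    -- adjacency survives a reversal.
    exchange : ∀ {a b x y} → suc a ≡ b → a + x ≡ b + y → suc y ≡ x
    exchange {a} {x = x} {y} refl eq = sym (+-cancelˡ-≡ a x (suc y) (trans eq (sym (+-suc a y))))

    comm₂ : ∀ a {x} b {y} → a + x ≡ b + y → x + a ≡ y + b
    comm₂ a {x} b {y} eq = trans (+-comm x a) (trans eq (+-comm b y))

  module _ {P : Placement} {F : List (Edge {n})} (L : Layout P F) where
    open Layout L

    injective-after : ∀ {u v} → frag P u ≡ frag P v → after P u ≡ after P v → u ≡ v
    injective-after {u} {v} e eq = injective e
      (+-cancelʳ-≡ (after P v) _ _ (trans (cong (before P u +_) (sym eq)) (size e)))

    flip-layout : ∀ c → Layout (flip c P) F
    flip-layout c = record
      { frag-idem = frag-idem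
      ; adj⇒      = adj⇒′
      ; adj⇐      = adj⇐′
      ; connected = connected
      ; injective = injective′
      ; size      = size′
      ; pred      = pred′
      ; succ      = succ′
      }
      where
      adj⇒′ : ∀ {u v} → Adj F u v → frag P u ≡ frag P v ×
              (suc (before (flip c P) u) ≡ before (flip c P) v ⊎
               suc (before (flip c P) v) ≡ before (flip c P) u)
      adj⇒′ {u} {v} uv with adj⇒ uv
      ... | e , o with frag P u ≟ c | frag P v ≟ c
      ...   | yes _ | yes _ = e , Sum.swap (Sum.map (λ q → exchange q (size e)) (λ q → exchange q (sym (size e))) o)
      ...   | no _  | no _  = e , o
      ...   | yes i | no j  = contradiction (trans (sym e) i) j
      ...   | no i  | yes j = contradiction (trans e j) i

      adj⇐′ : ∀ {u v} → frag P u ≡ frag P v → suc (before (flip c P) u) ≡ before (flip c P) v → Adj F u v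
      adj⇐′ {u} {v} e q with frag P u ≟ c | frag P v ≟ c
      ... | yes _ | yes _ = adj-sym (adj⇐ (sym e) (exchange q (comm₂ (before P u) (before P v) (size e))))
      ... | no _  | no _  = adj⇐ e q
      ... | yes i | no j  = contradiction (trans (sym e) i) j
      ... | no i  | yes j = contradiction (trans e j) i

      injective′ : ∀ {u v} → frag P u ≡ frag P v → before (flip c P) u ≡ before (flip c P) v → u ≡ v
      injective′ {u} {v} e q with frag P u ≟ c | frag P v ≟ c
      ... | yes _ | yes _ = injective-after e q
      ... | no _  | no _  = injective e q
      ... | yes i | no j  = contradiction (trans (sym e) i) j
      ... | no i  | yes j = contradiction (trans e j) i

      size′ : ∀ {u v} → frag P u ≡ frag P v →
              before (flip c P) u + after (flip c P) u ≡ before (flip c P) v + after (flip c P) v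
      size′ {u} {v} e with frag P u ≟ c | frag P v ≟ c
      ... | yes _ | yes _ = comm₂ (before P u) (before P v) (size e)
      ... | no _  | no _  = size e
      ... | yes i | no j  = contradiction (trans (sym e) i) j
      ... | no i  | yes j = contradiction (trans e j) i

      pred′ : ∀ {u k} → before (flip c P) u ≡ suc k → ∃[ v ] frag P v ≡ frag P u × before (flip c P) v ≡ k
      pred′ {u} q with frag P u ≟ c
      pred′ {u} q | yes i with succ q
      ... | v , e , r with frag P v ≟ c in eq
      ...   | yes _ = v , e , trans (cong (λ d → if does d then after P v else before P v) eq) r
      ...   | no j  = contradiction (trans e i) j
      pred′ {u} q | no i with pred q
      ... | v , e , r with frag P v ≟ c in eq
      ...   | yes j = contradiction (trans (sym e) j) i
      ...   | no _  = v , e , trans (cong (λ d → if does d then after P v else before P v) eq) r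

      succ′ : ∀ {u k} → after (flip c P) u ≡ suc k → ∃[ v ] frag P v ≡ frag P u × after (flip c P) v ≡ k
      succ′ {u} q with frag P u ≟ c
      succ′ {u} q | yes i with pred q
      ... | v , e , r with frag P v ≟ c in eq
      ...   | yes _ = v , e , trans (cong (λ d → if does d then before P v else after P v) eq) r
      ...   | no j  = contradiction (trans e i) j
      succ′ {u} q | no i with succ q
      ... | v , e , r with frag P v ≟ c in eq
      ...   | yes j = contradiction (trans (sym e) j) i
      ...   | no _  = v , e , trans (cong (λ d → if does d then before P v else after P v) eq) r

  flip-tip : ∀ c P {u} → Tip P u → Tip (flip c P) u
  flip-tip c P {u} t with frag P u ≟ c
  ... | yes _ = Sum.swap t
  ... | no _  = t

  flip-tip⁻ : ∀ c P {u} → Tip (flip c P) u → Tip P u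
  flip-tip⁻ c P {u} t with frag P u ≟ c
  ... | yes _ = Sum.swap t
  ... | no _  = t

  flip-before : ∀ c P {u} → frag P u ≡ c → before (flip c P) u ≡ after P u
  flip-before c P {u} e with frag P u ≟ c
  ... | yes _ = refl
  ... | no ¬e = contradiction e ¬e

  flip-after : ∀ c P {u} → frag P u ≡ c → after (flip c P) u ≡ before P u
  flip-after c P {u} e with frag P u ≟ c
  ... | yes _ = refl
  ... | no ¬e = contradiction e ¬e

  flip-before-≢ : ∀ c P {u} → frag P u ≢ c → before (flip c P) u ≡ before P u
  flip-before-≢ c P {u} ¬e with frag P u ≟ c
  ... | yes e = contradiction e ¬e
  ... | no _  = refl

  flip-after-≢ : ∀ c P {u} → frag P u ≢ c → after (flip c P) u ≡ after P u
  flip-after-≢ c P {u} ¬e with frag P u ≟ c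
  ... | yes e = contradiction e ¬e
  ... | no _  = refl

  -- Meaningful only if p is the last site of its fragment and q the first of its own.
  join : Fin n → Fin n → Placement → Placement
  join p q P = record
    { frag   = λ u → if does (frag P u ≟ frag P q) then frag P p else frag P u
    ; before = λ u → if does (frag P u ≟ frag P q) then before P u + suc (before P p) else before P u
    ; after  = λ u → if does (frag P u ≟ frag P p) then after P u + suc (after P q) else after P u
    }

  module _ (p q : Fin n) (P : Placement) (p≁q : frag P p ≢ frag P q) where
    private
      P′ = join p q P

    -- A case distinction that carries along the values of all conditionals in `join`; as the two
    -- fragments differ, three cases remain.
    data Side (u : Fin n) : Set where
      left  : frag P u ≡ frag P p → frag P′ u ≡ frag P p → before P′ u ≡ before P u →
              after P′ u ≡ after P u + suc (after P q) → Side u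
      right : frag P u ≡ frag P q → frag P′ u ≡ frag P p →
              before P′ u ≡ before P u + suc (before P p) → after P′ u ≡ after P u → Side u
      other : frag P u ≢ frag P p → frag P u ≢ frag P q → frag P′ u ≡ frag P u →
              before P′ u ≡ before P u → after P′ u ≡ after P u → Side u

    side : ∀ u → Side u
    side u with frag P u ≟ frag P p in eq | frag P u ≟ frag P q in eq′
    ... | yes i | yes j = contradiction (trans (sym i) j) p≁q
    ... | yes i | no j  = left i (trans (cong (λ d → if does d then frag P p else frag P u) eq′) i)
      (cong (λ d → if does d then before P u + suc (before P p) else before P u) eq′)
      (cong (λ d → if does d then after P u + suc (after P q) else after P u) eq)
    ... | no i  | yes j = right j (cong (λ d → if does d then frag P p else frag P u) eq′)
      (cong (λ d → if does d then before P u + suc (before P p) else before P u) eq′)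
      (cong (λ d → if does d then after P u + suc (after P q) else after P u) eq)
    ... | no i  | no j  = other i j (cong (λ d → if does d then frag P p else frag P u) eq′)
      (cong (λ d → if does d then before P u + suc (before P p) else before P u) eq′)
      (cong (λ d → if does d then after P u + suc (after P q) else after P u) eq)

    join-frag : ∀ {u v} → frag P u ≡ frag P v → frag P′ u ≡ frag P′ v
    join-frag e = cong (λ c → if does (c ≟ frag P q) then frag P p else c) e

    -- Positions never decrease under `join`, so what is zero afterwards was zero before.
    join-tip⁻ : ∀ {u} → Tip P′ u → Tip P u
    join-tip⁻ {u} t with side u
    ... | left  _ _ b a   = Sum.map (trans (sym b)) (λ z → m+n≡0⇒m≡0 _ (trans (sym a) z)) t
    ... | right _ _ b a   = Sum.map (λ z → m+n≡0⇒m≡0 _ (trans (sym b) z)) (trans (sym a)) t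
    ... | other _ _ _ b a = Sum.map (trans (sym b)) (trans (sym a)) t

    join-tip : ∀ {u} → frag P u ≢ frag P p → frag P u ≢ frag P q → Tip P u → Tip P′ u
    join-tip {u} i j t with side u
    ... | left e _ _ _    = contradiction e i
    ... | right e _ _ _   = contradiction e j
    ... | other _ _ _ b a = Sum.map (trans b) (trans a) t

    module _ {F : List (Edge {n})} (L : Layout P F) (p-last : after P p ≡ 0) (q-first : before P q ≡ 0) where
      open Layout L
      private
        F′ = (p , q) ∷ F

        before≤p : ∀ {u} → frag P u ≡ frag P p → before P u ≤ before P p
        before≤p {u} e = ≤-trans (m≤m+n _ (after P u))
          (≤-reflexive (trans (size e) (trans (cong (before P p +_) p-last) (+-identityʳ _))))

        weaken : ∀ {u v} → SameFragment F u v → SameFragment F′ u v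
        weaken = Star.map adj-weaken

        -- Sites of the first fragment gain the length of the second one behind them, those of the
        -- second the length of the first one ahead of them. The common total is the last position
        -- on the joined path.
        total : ∀ {u} → frag P u ≡ frag P p ⊎ frag P u ≡ frag P q →
                before P′ u + after P′ u ≡ before P p + suc (after P q)
        total {u} e with side u
        total (inj₁ e) | right f _ _ _   = contradiction (trans (sym e) f) p≁q
        total (inj₁ e) | other i _ _ _ _ = contradiction e i
        total (inj₂ e) | left f _ _ _    = contradiction (trans (sym f) e) p≁q
        total (inj₂ e) | other _ i _ _ _ = contradiction e i
        total {u} (inj₁ e) | left _ _ b a = begin
          before P′ u + after P′ u                     ≡⟨ cong₂ _+_ b a ⟩
          before P u + (after P u + suc (after P q))   ≡⟨ +-assoc (before P u) _ _ ⟨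
          (before P u + after P u) + suc (after P q)   ≡⟨ cong (_+ suc (after P q)) (size e) ⟩
          (before P p + after P p) + suc (after P q)   ≡⟨ cong (λ z → (before P p + z) + suc (after P q)) p-last ⟩
          (before P p + 0) + suc (after P q)           ≡⟨ cong (_+ suc (after P q)) (+-identityʳ (before P p)) ⟩
          before P p + suc (after P q)                 ∎
          where open ≡-Reasoning
        total {u} (inj₂ e) | right _ _ b a = begin
          before P′ u + after P′ u                     ≡⟨ cong₂ _+_ b a ⟩
          before P u + suc (before P p) + after P u    ≡⟨ cong (_+ after P u) (+-comm (before P u) _) ⟩
          suc (before P p) + before P u + after P u    ≡⟨ +-assoc (suc (before P p)) _ _ ⟩
          suc (before P p) + (before P u + after P u)  ≡⟨ cong (suc (before P p) +_) (size e) ⟩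
          suc (before P p) + (before P q + after P q)  ≡⟨ cong (λ z → suc (before P p) + (z + after P q)) q-first ⟩
          suc (before P p) + after P q                 ≡⟨ +-suc (before P p) (after P q) ⟨
          before P p + suc (after P q)                 ∎
          where open ≡-Reasoning

      join-layout : Layout P′ F′
      join-layout = record
        { frag-idem = idem
        ; adj⇒      = adj⇒′
        ; adj⇐      = adj⇐′
        ; connected = connected′
        ; injective = injective′
        ; size      = size′
        ; pred      = pred′
        ; succ      = succ′
        }
        where
        p-frag : frag P′ p ≡ frag P p
        p-frag with side p
        ... | left _ f _ _ = f
        ... | right _ f _ _ = f
        ... | other i _ _ _ _ = contradiction refl i

        q-frag : frag P′ q ≡ frag P p
        q-frag with side q
        ... | left _ f _ _ = f
        ... | right _ f _ _ = f
        ... | other _ i _ _ _ = contradiction refl i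

        idem : ∀ u → frag P′ (frag P′ u) ≡ frag P′ u
        idem u with side u
        ... | left _ f _ _  = trans (cong (frag P′) f) (trans (join-frag (frag-idem p)) (trans p-frag (sym f)))
        ... | right _ f _ _ = trans (cong (frag P′) f) (trans (join-frag (frag-idem p)) (trans p-frag (sym f)))
        ... | other _ _ f _ _ = trans (cong (frag P′) f) (join-frag (frag-idem u))

        pq : suc (before P′ p) ≡ before P′ q
        pq with side p | side q
        ... | right e _ _ _   | _               = contradiction e p≁q
        ... | other i _ _ _ _ | _               = contradiction refl i
        ... | left _ _ _ _    | left e _ _ _    = contradiction (sym e) p≁q
        ... | left _ _ _ _    | other _ i _ _ _ = contradiction refl i
        ... | left _ _ b _    | right _ _ b′ _  =
          trans (cong suc b) (sym (trans b′ (cong (_+ suc (before P p)) q-first)))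

        old : ∀ {u v} → Adj F u v → frag P′ u ≡ frag P′ v ×
              (suc (before P′ u) ≡ before P′ v ⊎ suc (before P′ v) ≡ before P′ u)
        old {u} {v} uv with adj⇒ uv
        ... | e , o = join-frag e , shift (side u) (side v)
          where
          plus : ∀ {a b a′ b′} k → a′ ≡ a + k → b′ ≡ b + k → suc a ≡ b → suc a′ ≡ b′
          plus _ refl refl refl = refl
          same : ∀ {a b a′ b′ : ℕ} → a′ ≡ a → b′ ≡ b → suc a ≡ b → suc a′ ≡ b′
          same refl refl refl = refl
          shift : Side u → Side v → suc (before P′ u) ≡ before P′ v ⊎ suc (before P′ v) ≡ before P′ u
          shift (left _ _ b _)    (left _ _ b′ _)    = Sum.map (same b b′) (same b′ b) o
          shift (right _ _ b _)   (right _ _ b′ _)   = Sum.map (plus _ b b′) (plus _ b′ b) o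
          shift (other _ _ _ b _) (other _ _ _ b′ _) = Sum.map (same b b′) (same b′ b) o
          shift (left f _ _ _)    (right g _ _ _)    = contradiction (trans (sym f) (trans e g)) p≁q
          shift (left f _ _ _)    (other i _ _ _ _)  = contradiction (trans (sym e) f) i
          shift (right f _ _ _)   (left g _ _ _)     = contradiction (trans (sym g) (trans (sym e) f)) p≁q
          shift (right f _ _ _)   (other _ i _ _ _)  = contradiction (trans (sym e) f) i
          shift (other i _ _ _ _) (left g _ _ _)     = contradiction (trans e g) i
          shift (other _ i _ _ _) (right g _ _ _)    = contradiction (trans e g) i

        adj⇒′ : ∀ {u v} → Adj F′ u v → frag P′ u ≡ frag P′ v ×
                (suc (before P′ u) ≡ before P′ v ⊎ suc (before P′ v) ≡ before P′ u)
        adj⇒′ (inj₁ (here refl)) = trans p-frag (sym q-frag) , inj₁ pq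
        adj⇒′ (inj₂ (here refl)) = trans q-frag (sym p-frag) , inj₂ pq
        adj⇒′ (inj₁ (there uv))  = old (inj₁ uv)
        adj⇒′ (inj₂ (there uv))  = old (inj₂ uv)

        adj⇐′ : ∀ {u v} → frag P′ u ≡ frag P′ v → suc (before P′ u) ≡ before P′ v → Adj F′ u v
        adj⇐′ {u} {v} e s with side u | side v
        ... | left f _ b _ | left g _ b′ _ =
          adj-weaken (adj⇐ (trans f (sym g)) (trans (cong suc (sym b)) (trans s b′)))
        ... | right f _ b _ | right g _ b′ _ =
          adj-weaken (adj⇐ (trans f (sym g))
            (+-cancelʳ-≡ _ _ _ (trans (cong suc (sym b)) (trans s b′))))
        ... | other _ _ f b _ | other _ _ g b′ _ =
          adj-weaken (adj⇐ (trans (sym f) (trans e g)) (trans (cong suc (sym b)) (trans s b′)))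
        ... | left _ f _ _ | other i _ g _ _ = contradiction (trans (sym g) (trans (sym e) f)) i
        ... | right _ f _ _ | other i _ g _ _ = contradiction (trans (sym g) (trans (sym e) f)) i
        ... | other i _ f _ _ | left _ g _ _ = contradiction (trans (sym f) (trans e g)) i
        ... | other i _ f _ _ | right _ g _ _ = contradiction (trans (sym f) (trans e g)) i
        ... | right f _ b _ | left g _ b′ _ =
          contradiction (≤-trans (≤-reflexive (trans (cong suc (sym b)) (trans s b′))) (before≤p g))
            (<⇒≱ (≤-trans (m≤n+m (suc (before P p)) (before P u)) (n≤1+n _)))
        -- The first fragment stops at position `before P p` and the second now starts right after
        -- it, so the only consecutive sites across the seam are p and q.
        ... | left f _ b _ | right g _ b′ _ = subst₂ (Adj F′) (sym u≡p) (sym v≡q) (inj₁ (here refl))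
          where
          s′ : before P u ≡ before P v + before P p
          s′ = suc-injective (trans (cong suc (sym b)) (trans s (trans b′ (+-suc (before P v) _))))
          v-first : before P v ≡ 0
          v-first = n≤0⇒n≡0 (+-cancelʳ-≤ (before P p) _ _ (≤-trans (≤-reflexive (sym s′)) (before≤p f)))
          u≡p : u ≡ p
          u≡p = injective f (trans s′ (cong (_+ before P p) v-first))
          v≡q : v ≡ q
          v≡q = injective g (trans v-first (sym q-first))

        connected′ : ∀ {u v} → frag P′ u ≡ frag P′ v → SameFragment F′ u v
        connected′ {u} {v} e with side u | side v
        ... | left f _ _ _ | left g _ _ _ = weaken (connected (trans f (sym g)))
        ... | right f _ _ _ | right g _ _ _ = weaken (connected (trans f (sym g)))
        ... | other _ _ f _ _ | other _ _ g _ _ = weaken (connected (trans (sym f) (trans e g)))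
        ... | left f _ _ _ | right g _ _ _ =
          weaken (connected f) ◅◅ inj₁ (here refl) ◅ weaken (connected (sym g))
        ... | right f _ _ _ | left g _ _ _ =
          weaken (connected f) ◅◅ inj₂ (here refl) ◅ weaken (connected (sym g))
        ... | left _ f _ _ | other i _ g _ _ = contradiction (trans (sym g) (trans (sym e) f)) i
        ... | right _ f _ _ | other i _ g _ _ = contradiction (trans (sym g) (trans (sym e) f)) i
        ... | other i _ f _ _ | left _ g _ _ = contradiction (trans (sym f) (trans e g)) i
        ... | other i _ f _ _ | right _ g _ _ = contradiction (trans (sym f) (trans e g)) i

        injective′ : ∀ {u v} → frag P′ u ≡ frag P′ v → before P′ u ≡ before P′ v → u ≡ v
        injective′ {u} {v} e s with side u | side v
        ... | left f _ b _ | left g _ b′ _ = injective (trans f (sym g)) (trans (sym b) (trans s b′))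
        ... | right f _ b _ | right g _ b′ _ =
          injective (trans f (sym g)) (+-cancelʳ-≡ _ _ _ (trans (sym b) (trans s b′)))
        ... | other _ _ f b _ | other _ _ g b′ _ =
          injective (trans (sym f) (trans e g)) (trans (sym b) (trans s b′))
        ... | left f _ b _ | right g _ b′ _ =
          contradiction (before≤p f) (<⇒≱ (≤-trans (m≤n+m (suc (before P p)) (before P v))
            (≤-reflexive (trans (sym b′) (trans (sym s) b)))))
        ... | right g _ b′ _ | left f _ b _ =
          contradiction (before≤p f) (<⇒≱ (≤-trans (m≤n+m (suc (before P p)) (before P u))
            (≤-reflexive (trans (sym b′) (trans s b)))))
        ... | left _ f _ _ | other i _ g _ _ = contradiction (trans (sym g) (trans (sym e) f)) i
        ... | right _ f _ _ | other i _ g _ _ = contradiction (trans (sym g) (trans (sym e) f)) i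
        ... | other i _ f _ _ | left _ g _ _ = contradiction (trans (sym f) (trans e g)) i
        ... | other i _ f _ _ | right _ g _ _ = contradiction (trans (sym f) (trans e g)) i

        size′ : ∀ {u v} → frag P′ u ≡ frag P′ v → before P′ u + after P′ u ≡ before P′ v + after P′ v
        size′ {u} {v} e with side u | side v
        ... | left f _ _ _ | left g _ _ _ = trans (total (inj₁ f)) (sym (total (inj₁ g)))
        ... | left f _ _ _ | right g _ _ _ = trans (total (inj₁ f)) (sym (total (inj₂ g)))
        ... | right f _ _ _ | left g _ _ _ = trans (total (inj₂ f)) (sym (total (inj₁ g)))
        ... | right f _ _ _ | right g _ _ _ = trans (total (inj₂ f)) (sym (total (inj₂ g)))
        ... | other _ _ f b a | other _ _ g b′ a′ =
          trans (cong₂ _+_ b a) (trans (size (trans (sym f) (trans e g))) (sym (cong₂ _+_ b′ a′)))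
        ... | left _ f _ _ | other i _ g _ _ = contradiction (trans (sym g) (trans (sym e) f)) i
        ... | right _ f _ _ | other i _ g _ _ = contradiction (trans (sym g) (trans (sym e) f)) i
        ... | other i _ f _ _ | left _ g _ _ = contradiction (trans (sym f) (trans e g)) i
        ... | other i _ f _ _ | right _ g _ _ = contradiction (trans (sym f) (trans e g)) i

        pred′ : ∀ {u k} → before P′ u ≡ suc k → ∃[ v ] frag P′ v ≡ frag P′ u × before P′ v ≡ k
        pred′ {u} {k} s with side u
        ... | left f _ b _ with pred (trans (sym b) s)
        ...   | v , e , s′ with side v
        ...     | left _ _ b′ _ = v , join-frag e , trans b′ s′
        ...     | right g _ _ _ = contradiction (trans (sym f) (trans (sym e) g)) p≁q
        ...     | other i _ _ _ _ = contradiction (trans e f) i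
        pred′ {u} {k} s | other i j f b _ with pred (trans (sym b) s)
        ...   | v , e , s′ with side v
        ...     | left g _ _ _ = contradiction (trans (sym e) g) i
        ...     | right g _ _ _ = contradiction (trans (sym e) g) j
        ...     | other _ _ _ b′ _ = v , join-frag e , trans b′ s′
        pred′ {u} {k} s | right f f′ b _ with before P u in z
        -- The first site of the second fragment has its predecessor across the seam.
        ...   | zero with side p
        ...     | left _ g b′ _ = p , trans g (sym f′) , trans b′ (suc-injective (trans (sym b) s))
        ...     | right g _ _ _ = contradiction g p≁q
        ...     | other i _ _ _ _ = contradiction refl i
        pred′ {u} {k} s | right f f′ b _ | suc j with pred z
        ...   | v , e , s′ with side v
        ...     | left g _ _ _ = contradiction (trans (sym g) (trans e f)) p≁q
        ...     | right _ _ b′ _ = v , join-frag e ,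
                    trans b′ (trans (cong (_+ suc (before P p)) s′) (suc-injective (trans (sym b) s)))
        ...     | other _ i _ _ _ = contradiction (trans e f) i

        succ′ : ∀ {u k} → after P′ u ≡ suc k → ∃[ v ] frag P′ v ≡ frag P′ u × after P′ v ≡ k
        succ′ {u} {k} s with side u
        ... | right f _ _ a with succ (trans (sym a) s)
        ...   | v , e , s′ with side v
        ...     | right _ _ _ a′ = v , join-frag e , trans a′ s′
        ...     | left g _ _ _ = contradiction (trans (sym g) (trans e f)) p≁q
        ...     | other _ i _ _ _ = contradiction (trans e f) i
        succ′ {u} {k} s | other i j f _ a with succ (trans (sym a) s)
        ...   | v , e , s′ with side v
        ...     | left g _ _ _ = contradiction (trans (sym e) g) i
        ...     | right g _ _ _ = contradiction (trans (sym e) g) j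
        ...     | other _ _ _ _ a′ = v , join-frag e , trans a′ s′
        succ′ {u} {k} s | left f f′ _ a with after P u in z
        ...   | zero with side q
        ...     | right _ g _ a′ = q , trans g (sym f′) , trans a′ (suc-injective (trans (sym a) s))
        ...     | left g _ _ _ = contradiction (sym g) p≁q
        ...     | other _ i _ _ _ = contradiction refl i
        succ′ {u} {k} s | left f f′ _ a | suc j with succ z
        ...   | v , e , s′ with side v
        ...     | right g _ _ _ = contradiction (trans (sym f) (trans (sym e) g)) p≁q
        ...     | left _ _ _ a′ = v , join-frag e ,
                    trans a′ (trans (cong (_+ suc (after P q)) s′) (suc-injective (trans (sym a) s)))
        ...     | other i _ _ _ _ = contradiction (trans e f) i

-- Merging two fragments along a valid edge

module _ {n : ℕ} where
  open Placement

  -- The choice is a boolean, computed by `≡ᵇ 0` where it is used, so that it reduces together with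
  -- the program's test whether a position is zero.
  turn : Bool → Fin n → Placement → Placement
  turn true  c P = P
  turn false c P = flip c P

  orientLast orientFirst : Fin n → Placement → Placement
  orientLast  p P = turn (after P p ℕ.≡ᵇ 0) (frag P p) P
  orientFirst q P = turn (before P q ℕ.≡ᵇ 0) (frag P q) P

  merge : Fin n → Fin n → Placement → Placement
  merge p q P = join p q (orientFirst q (orientLast p P))

  frag-turn : ∀ b c P → frag (turn b c P) ≡ frag P
  frag-turn true  c P = refl
  frag-turn false c P = refl

  turn-layout : ∀ b c {P F} → Layout P F → Layout (turn b c P) F
  turn-layout true  c L = L
  turn-layout false c L = flip-layout L c

  turn-tip : ∀ b c P {u} → Tip P u → Tip (turn b c P) u
  turn-tip true  c P t = t
  turn-tip false c P t = flip-tip c P t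

  turn-tip⁻ : ∀ b c P {u} → Tip (turn b c P) u → Tip P u
  turn-tip⁻ true  c P t = t
  turn-tip⁻ false c P t = flip-tip⁻ c P t

  turn-after-≢ : ∀ b c P {u} → frag P u ≢ c → after (turn b c P) u ≡ after P u
  turn-after-≢ true  c P ¬e = refl
  turn-after-≢ false c P ¬e = flip-after-≢ c P ¬e

  orientLast-after : ∀ p P → Tip P p → after (orientLast p P) p ≡ 0
  orientLast-after p P t with after P p in z
  orientLast-after p P t        | zero  = z
  orientLast-after p P (inj₁ z) | suc _ = trans (flip-after (frag P p) P refl) z

  orientFirst-before : ∀ q P → Tip P q → before (orientFirst q P) q ≡ 0
  orientFirst-before q P t with before P q in z
  orientFirst-before q P t        | zero  = z
  orientFirst-before q P (inj₂ z) | suc _ = trans (flip-before (frag P q) P refl) z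

  frag-orient : ∀ p q P → frag (orientFirst q (orientLast p P)) ≡ frag P
  frag-orient p q P = trans (frag-turn (before (orientLast p P) q ℕ.≡ᵇ 0) (frag (orientLast p P) q) (orientLast p P))
    (frag-turn (after P p ℕ.≡ᵇ 0) (frag P p) P)

  module _ (P : Placement) {p q : Fin n} (valid : Valid P p q) where
    private
      Q₁ = orientLast p P
      Q₂ = orientFirst q Q₁
      b₁ = after P p ℕ.≡ᵇ 0
      b₂ = before Q₁ q ℕ.≡ᵇ 0
      fragQ₂ : frag Q₂ ≡ frag P
      fragQ₂ = frag-orient p q P
      p≁q : frag Q₂ p ≢ frag Q₂ q
      p≁q = subst (λ f → f p ≢ f q) (sym fragQ₂) (proj₂ (proj₂ valid))

    -- The second reversal concerns the fragment of q, which is not that of p, and so does not undo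
    -- the first.
    merge-last : after Q₂ p ≡ 0
    merge-last = trans (turn-after-≢ b₂ (frag Q₁ q) Q₁
        (subst (λ f → f p ≢ f q) (sym (frag-turn b₁ (frag P p) P)) (proj₂ (proj₂ valid))))
      (orientLast-after p P (proj₁ valid))

    merge-first : before Q₂ q ≡ 0
    merge-first = orientFirst-before q Q₁ (turn-tip b₁ (frag P p) P (proj₁ (proj₂ valid)))

    merge-layout : ∀ {F} → Layout P F → Layout (merge p q P) ((p , q) ∷ F)
    merge-layout L = join-layout p q Q₂ p≁q
      (turn-layout b₂ (frag Q₁ q) (turn-layout b₁ (frag P p) L)) merge-last merge-first

    merge-tip⁻ : ∀ {u} → Tip (merge p q P) u → Tip P u
    merge-tip⁻ = turn-tip⁻ b₁ (frag P p) P ∘ turn-tip⁻ b₂ (frag Q₁ q) Q₁ ∘ join-tip⁻ p q Q₂ p≁q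

    merge-tip : ∀ {u} → frag P u ≢ frag P p → frag P u ≢ frag P q → Tip P u → Tip (merge p q P) u
    merge-tip {u} i j = join-tip p q Q₂ p≁q
        (subst (λ f → f u ≢ f p) (sym fragQ₂) i) (subst (λ f → f u ≢ f q) (sym fragQ₂) j)
      ∘ turn-tip b₂ (frag Q₁ q) Q₁ ∘ turn-tip b₁ (frag P p) P

    merge-frag : ∀ u → frag (merge p q P) u ≡ (if does (frag P u ≟ frag P q) then frag P p else frag P u)
    merge-frag u = cong (λ f → if does (f u ≟ f q) then f p else f u) fragQ₂

    merge-cong : ∀ {u v} → frag P u ≡ frag P v → frag (merge p q P) u ≡ frag (merge p q P) v
    merge-cong {u} {v} e = trans (merge-frag u)
      (trans (cong (λ c → if does (c ≟ frag P q) then frag P p else c) e) (sym (merge-frag v)))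

    merge-frag-≢ : ∀ {u} → frag P u ≢ frag P q → frag (merge p q P) u ≡ frag P u
    merge-frag-≢ {u} ¬e with frag P u ≟ frag P q | merge-frag u
    ... | yes e | _ = contradiction e ¬e
    ... | no _  | f = f

    merge-frag-≡ : ∀ {u} → frag P u ≡ frag P q → frag (merge p q P) u ≡ frag P p
    merge-frag-≡ {u} e with frag P u ≟ frag P q | merge-frag u
    ... | yes _ | f = f
    ... | no ¬e | _ = contradiction e ¬e

    -- The merged fragment inherits the name of p's, so it cannot be mistaken for a third fragment.
    merge-frag⁻ : ∀ {u v} → frag P v ≢ frag P p → frag P v ≢ frag P q →
                  frag (merge p q P) u ≡ frag (merge p q P) v → frag P u ≡ frag P v
    merge-frag⁻ {u} {v} i j e with frag P u ≟ frag P q | merge-frag u | merge-frag-≢ j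
    ... | yes _ | f | g = contradiction (trans (sym g) (trans (sym e) f)) i
    ... | no _  | f | g = trans (sym f) (trans e g)

    merge-frag-split : ∀ {u} → frag (merge p q P) u ≡ frag (merge p q P) p →
                       frag P u ≡ frag P p ⊎ frag P u ≡ frag P q
    merge-frag-split {u} e with frag P u ≟ frag P q | merge-frag u | merge-frag-≢ (proj₂ (proj₂ valid))
    ... | yes i | _ | _ = inj₂ i
    ... | no _  | f | g = inj₁ (trans (sym f) (trans e g))

    -- Therefore an edge that is shortest among the valid ones stays so after a merge, as long as it
    -- stays valid itself.
    merge-valid⁻ : ∀ {u v} → Valid (merge p q P) u v → Valid P u v
    merge-valid⁻ (s , t , ne) = merge-tip⁻ s , merge-tip⁻ t , ne ∘ merge-cong

  tip? : (P : Placement {n}) (u : Fin n) → Dec (Tip P u)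
  tip? P u = (before P u ℕ.≟ 0) ⊎-dec (after P u ℕ.≟ 0)

  valid? : (P : Placement {n}) (u v : Fin n) → Dec (Valid P u v)
  valid? P u v = tip? P u ×-dec tip? P v ×-dec ¬? (frag P u ≟ frag P v)

  module _ {P : Placement} {F : List (Edge {n})} (L : Layout P F) where
    open Layout L

    private
      no-step : ∀ {u v} → Adj F u v → after P u ≡ 0 → suc (before P u) ≢ before P v
      no-step {u} {v} uv z s = contradiction
        (≤-trans (≤-reflexive s) (≤-trans (m≤m+n _ (after P v))
          (≤-reflexive (trans (sym (size (proj₁ (adj⇒ uv)))) (trans (cong (before P u +_) z) (+-identityʳ _))))))
        1+n≰n

    -- All neighbours of an end lie on the same side of it, hence at the same position.
    tip⇒endpoint : ∀ {u} → Tip P u → Endpoint F u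
    tip⇒endpoint {u} t v w uv uw with adj⇒ uv | adj⇒ uw
    tip⇒endpoint {u} (inj₁ z) v w uv uw | _ , inj₂ s | _         = contradiction (trans s z) λ ()
    tip⇒endpoint {u} (inj₁ z) v w uv uw | _ , inj₁ _ | _ , inj₂ s = contradiction (trans s z) λ ()
    tip⇒endpoint {u} (inj₂ z) v w uv uw | _ , inj₁ s | _         = contradiction s (no-step uv z)
    tip⇒endpoint {u} (inj₂ z) v w uv uw | _ , inj₂ _ | _ , inj₁ s = contradiction s (no-step uw z)
    tip⇒endpoint {u} (inj₁ z) v w uv uw | e , inj₁ s | e′ , inj₁ s′ =
      injective (trans (sym e) e′) (trans (sym s) s′)
    tip⇒endpoint {u} (inj₂ z) v w uv uw | e , inj₂ s | e′ , inj₂ s′ =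
      injective (trans (sym e) e′) (suc-injective (trans s (sym s′)))

    same⇒frag : ∀ {u v} → SameFragment F u v → frag P u ≡ frag P v
    same⇒frag ε        = refl
    same⇒frag (s ◅ ss) = trans (proj₁ (adj⇒ s)) (same⇒frag ss)

    interior : ∀ {u} → ¬ Tip P u → ∃[ v ] ∃[ w ] v ≢ w × Adj F u v × Adj F u w
    interior {u} ¬t with before P u in z | after P u in z′
    ... | zero  | _    = contradiction (inj₁ refl) ¬t
    ... | suc _ | zero = contradiction (inj₂ refl) ¬t
    ... | suc i | suc j with pred z | succ z′
    ...   | v , e , s | w , e′ , s′ = v , w , v≢w , adj-sym (adj⇐ e (trans (cong suc s) (sym z))) , adj⇐ (sym e′) (sym t)
      where
      t : before P w ≡ suc (before P u)
      t = +-cancelʳ-≡ j _ _ (trans (cong (before P w +_) (sym s′)) (trans (size e′)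
        (trans (cong (before P u +_) z′) (+-suc (before P u) j))))
      v≢w : v ≢ w
      v≢w refl = m≢1+m+n i (trans (sym s) (trans t (cong suc (trans z (sym (+-comm i 1))))))

    at : ∀ u {k} → k ≤ before P u → ∃[ v ] frag P v ≡ frag P u × before P v ≡ k
    at u = go u refl
      where
      go : ∀ {m} u → before P u ≡ m → ∀ {k} → k ≤ m → ∃[ v ] frag P v ≡ frag P u × before P v ≡ k
      go u e k≤m with ℕ.m≤n⇒m<n∨m≡n k≤m
      go u e k≤m | inj₂ refl = u , refl , e
      go u e k≤m | inj₁ (s≤s k≤m′) with pred e
      ... | v , f , s with go v s k≤m′
      ...   | w , g , t = w , trans g f , t

    first : ∀ u → ∃[ v ] frag P v ≡ frag P u × before P v ≡ 0
    first u = at u z≤n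

    last : ∀ u → ∃[ v ] frag P v ≡ frag P u × after P v ≡ 0
    last u = go u refl
      where
      go : ∀ {m} u → after P u ≡ m → ∃[ v ] frag P v ≡ frag P u × after P v ≡ 0
      go {zero} u e = u , refl , e
      go {suc m} u e with succ e
      ... | v , f , s with go v s
      ...   | w , g , t = w , trans g f , t

    -- Pigeonhole: the positions from 0 up to that of u are all occupied, by different sites.
    before<n : ∀ u → before P u < n
    before<n u = Fin.injective⇒≤ {f = λ i → proj₁ (pos i)} λ {i} {j} e → toℕ-injective
      (trans (sym (proj₂ (proj₂ (pos i)))) (trans (cong (before P) e) (proj₂ (proj₂ (pos j)))))
      where
      pos : (i : Fin (suc (before P u))) → ∃[ v ] frag P v ≡ frag P u × before P v ≡ toℕ i
      pos i = at u (ℕ.≤-pred (toℕ<n i))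

    size<n : ∀ u → before P u + after P u < n
    size<n u with last u
    ... | v , e , z = subst (_< n)
      (trans (sym (+-identityʳ _)) (trans (cong (before P v +_) (sym z)) (size e))) (before<n v)

    after<n : ∀ u → after P u < n
    after<n u = ≤-<-trans (m≤n+m _ (before P u)) (size<n u)

-- Agreement with the sorted order

module Greedy {n : ℕ} {c ℓ₁ ℓ₂} (D : Distances n c ℓ₁ ℓ₂) where
  open Distances D
  private module O = DecTotalOrder order
  open Placement

  d-swap : ∀ {u v t} → d u v ≼ t → d v u ≼ t
  d-swap {u} {v} = O.≤-respˡ-≈ (d-sym u v)

  Near : Distance → List (Edge {n}) → Fin n → Fin n → Set _
  Near t F u v = Adj F u v × d u v ≼ t

  Saturated : Distance → List (Edge {n}) → Fin n → Set _
  Saturated t F u = ∃[ v ] ∃[ w ] v ≢ w × Near t F u v × Near t F u w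

  -- The edges of F no longer than (x , y) already prevent (x , y) from being included.
  Blocked : List (Edge {n}) → Fin n → Fin n → Set _
  Blocked F x y = Saturated (d x y) F x ⊎ Saturated (d x y) F y ⊎ Star (Near (d x y) F) x y

  Light : Placement → List (Edge {n}) → Distance → Fin n → Set _
  Light P F t x = ∀ {u v} → Adj F u v → frag P u ≡ frag P x → d u v ≼ t

  -- The invariant that ties local merges to the global order. `Blocked` mentions no placement and
  -- persists as F grows, so a pair changes sides at most once, at the merge that makes it invalid;
  -- and when a single fragment is left, every pair is blocked.
  Settled : Placement → List (Edge {n}) → Set _
  Settled P F = ∀ x y → x ≢ y →
    Blocked F x y ⊎ (Valid P x y × Light P F (d x y) x × Light P F (d x y) y)

  blocked-weaken : ∀ {e F x y} → Blocked F x y → Blocked (e ∷ F) x y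
  blocked-weaken {e} {F} = Sum.map sat (Sum.map sat (Star.map near))
    where
    near : ∀ {t u v} → Near t F u v → Near t (e ∷ F) u v
    near (a , b) = adj-weaken a , b
    sat : ∀ {t u} → Saturated t F u → Saturated t (e ∷ F) u
    sat (v , w , ne , a , b) = v , w , ne , near a , near b

  module _ {P : Placement} {F : List (Edge {n})} (L : Layout P F) where
    open Layout L

    blocked⇒¬valid : ∀ {x y} → Blocked F x y → ¬ Valid P x y
    blocked⇒¬valid (inj₁ (v , w , ne , (a , _) , (b , _))) (s , _ , _) = ne (tip⇒endpoint L s v w a b)
    blocked⇒¬valid (inj₂ (inj₁ (v , w , ne , (a , _) , (b , _)))) (_ , t , _) = ne (tip⇒endpoint L t v w a b)
    blocked⇒¬valid (inj₂ (inj₂ ss)) (_ , _ , ne) = ne (same⇒frag L (Star.map proj₁ ss))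

    light⇒saturated : ∀ {x t} → Light P F t x → ¬ Tip P x → Saturated t F x
    light⇒saturated l ¬t with interior L ¬t
    ... | v , w , ne , a , b = v , w , ne , (a , l a refl) , (b , l b refl)

    -- A pair is invalid because of x, because of y, or because both lie in one fragment: the three
    -- cases of `Blocked`. Lightness bounds the edges that witness each of them.
    light⇒blocked : ∀ {x y} → Light P F (d x y) x → Light P F (d x y) y → ¬ Valid P x y → Blocked F x y
    light⇒blocked {x} {y} lx ly ¬v with tip? P x | tip? P y | frag P x ≟ frag P y
    ... | no ¬t | _     | _     = inj₁ (light⇒saturated lx ¬t)
    ... | yes _ | no ¬t | _     = inj₂ (inj₁ (light⇒saturated ly ¬t))
    ... | yes s | yes t | no ne = contradiction (s , t , ne) ¬v
    ... | yes _ | yes _ | yes e = inj₂ (inj₂ (lift refl (connected e)))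
      where
      -- The path never leaves the fragment of x, so lightness applies to each of its edges.
      lift : ∀ {u v} → frag P u ≡ frag P x → SameFragment F u v → Star (Near (d x y) F) u v
      lift f ε        = ε
      lift f (s ◅ ss) = (s , lx s f) ◅ lift (trans (sym (proj₁ (adj⇒ s))) f) ss

  module _ {P : Placement} {F : List (Edge {n})} (L : Layout P F) {p q : Fin n} (valid : Valid P p q)
           (minimal : ∀ {x y} → Valid P x y → frag P x ≡ frag P p ⊎ frag P x ≡ frag P q → d p q ≼ d x y)
           (S : Settled P F) where
    private
      P′ = merge p q P
      F′ = (p , q) ∷ F

      light-pq : Light P F (d p q) p × Light P F (d p q) q
      light-pq with S p q (λ p≡q → proj₂ (proj₂ valid) (cong (frag P) p≡q))
      ... | inj₁ b       = contradiction valid (blocked⇒¬valid L b)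
      ... | inj₂ (_ , l) = l

      merged : ∀ {x} → frag P x ≡ frag P p ⊎ frag P x ≡ frag P q → frag P′ x ≡ frag P′ p
      merged (inj₁ e) = merge-cong P valid e
      merged (inj₂ e) = trans (merge-frag-≡ P valid e) (sym (merge-frag-≢ P valid (proj₂ (proj₂ valid))))

    -- If the fragment of x takes part in the merge, it gains (p , q) and the edges of the other
    -- part. The latter are no longer than (p , q), which was valid and settled, and (p , q) is no
    -- longer than t.
    merge-light : ∀ {x t} → Light P F t x →
                  (frag P x ≡ frag P p ⊎ frag P x ≡ frag P q → d p q ≼ t) → Light P′ F′ t x
    merge-light {x} {t} l heavy {u} {v} uv e
      with (frag P x ≟ frag P p) ⊎-dec (frag P x ≟ frag P q)
    ... | no i = outside uv
      where
      e′ = merge-frag⁻ P valid {u} (i ∘ inj₁) (i ∘ inj₂) e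
      e″ = merge-frag⁻ P valid {v} (i ∘ inj₁) (i ∘ inj₂)
             (trans (sym (proj₁ (Layout.adj⇒ (merge-layout P valid L) uv))) e)
      outside : Adj F′ u v → d u v ≼ t
      outside (inj₁ (here refl)) = contradiction (inj₁ (sym e′)) i
      outside (inj₂ (here refl)) = contradiction (inj₁ (sym e″)) i
      outside (inj₁ (there uv))  = l (inj₁ uv) e′
      outside (inj₂ (there uv))  = l (inj₂ uv) e′
    ... | yes m = inside uv (merge-frag-split P valid (trans e (merged m)))
      where
      old : Adj F u v → frag P u ≡ frag P p ⊎ frag P u ≡ frag P q → d u v ≼ t
      old uv s = O.trans (Sum.[ proj₁ light-pq uv , proj₂ light-pq uv ] s) (heavy m)
      inside : Adj F′ u v → frag P u ≡ frag P p ⊎ frag P u ≡ frag P q → d u v ≼ t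
      inside (inj₁ (here refl)) _ = heavy m
      inside (inj₂ (here refl)) _ = d-swap (heavy m)
      inside (inj₁ (there uv))    = old (inj₁ uv)
      inside (inj₂ (there uv))    = old (inj₂ uv)

    merge-settled : Settled P′ F′
    merge-settled x y x≢y with S x y x≢y
    ... | inj₁ b = inj₁ (blocked-weaken b)
    ... | inj₂ (v , lx , ly) = settle (valid? P′ x y)
      where
      lx′ : Light P′ F′ (d x y) x
      lx′ = merge-light lx (minimal v)
      ly′ : Light P′ F′ (d x y) y
      -- `minimal` speaks of edges by their first site, so the edge is reversed to look at it from
      -- y.
      ly′ = merge-light ly (λ m → O.≤-respʳ-≈ (d-sym y x)
              (minimal (proj₁ (proj₂ v) , proj₁ v , proj₂ (proj₂ v) ∘ sym) m))
      settle : Dec (Valid P′ x y) → Blocked F′ x y ⊎ (Valid P′ x y × Light P′ F′ (d x y) x × Light P′ F′ (d x y) y)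
      settle (yes v′) = inj₂ (v′ , lx′ , ly′)
      settle (no ¬v′) = inj₁ (light⇒blocked (merge-layout P valid L) lx′ ly′ ¬v′)

-- The tour and the sorted scan obtained from a complete path

module _ {n : ℕ} where
  open Placement

  -- The heuristic collects the edges in an order and orientation other than those of the merges; a
  -- layout depends on neither.
  layout-resp : ∀ {P F G} → (∀ {u v} → Adj {n} F u v → Adj G u v) →
                (∀ {u v} → Adj {n} G u v → Adj F u v) → Layout P F → Layout P G
  layout-resp F⊆G G⊆F L = record
    { frag-idem = frag-idem
    ; adj⇒      = adj⇒ ∘ G⊆F
    ; adj⇐      = λ e s → F⊆G (adj⇐ e s)
    ; connected = Star.map F⊆G ∘ connected
    ; injective = injective
    ; size      = size
    ; pred      = pred
    ; succ      = succ
    }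
    where open Layout L

  abstract
    adj? : (F : List (Edge {n})) (u v : Fin n) → Dec (Adj F u v)
    adj? F u v = ((u , v) ∈? F) ⊎-dec ((v , u) ∈? F)
      where open import Data.List.Membership.DecPropositional (≡-dec (_≟_ {n}) _≟_) using (_∈?_)

  allEdges-unique : Unique (allEdges n)
  allEdges-unique = Unique.filter⁺ (uncurry Fin._<?_) (Unique.cartesianProduct⁺ (Unique.allFin⁺ n) (Unique.allFin⁺ n))

  ∈-allEdges⁺ : ∀ {u v} → u Fin.< v → (u , v) ∈ allEdges n
  ∈-allEdges⁺ = ∈-filter⁺ (uncurry Fin._<?_) (∈-cartesianProduct⁺ (∈-allFin _) (∈-allFin _))

  ∈-allEdges⁻ : ∀ {u v} → (u , v) ∈ allEdges n → u Fin.< v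
  ∈-allEdges⁻ = proj₂ ∘ ∈-filter⁻ (uncurry Fin._<?_) {xs = Data.List.cartesianProduct (allFin n) (allFin n)}

  module _ {P : Placement} {F : List (Edge {n})} (L : Layout P F) where
    open Layout L

    layout-irrefl : ∀ {u} → ¬ Adj F u u
    layout-irrefl uu with adj⇒ uu
    ... | _ , inj₁ s = 1+n≢n s
    ... | _ , inj₂ s = 1+n≢n s

    -- Removing an edge leaves its two sites as endpoints of distinct fragments.
    unused-joins : ∀ {I u v} → (∀ {x y} → Adj I x y → Adj F x y) → Adj F u v → ¬ Adj I u v → Joins (u , v) I
    unused-joins {I} {u} {v} I⊆F uv ¬uv =
      endpoint uv ¬uv , endpoint (adj-sym uv) (¬uv ∘ adj-sym) , separate (proj₂ (adj⇒ uv))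
      where
      -- In F a site has at most one neighbour on each side; on the side where u has v, it has none
      -- in I.
      endpoint : ∀ {u v} → Adj F u v → ¬ Adj I u v → Endpoint I u
      endpoint {u} {v} uv ¬uv x y ux uy with adj⇒ uv | adj⇒ (I⊆F ux) | adj⇒ (I⊆F uy)
      ... | _ , _      | e , inj₁ s | f , inj₁ t = injective (trans (sym e) f) (trans (sym s) t)
      ... | _ , _      | e , inj₂ s | f , inj₂ t = injective (trans (sym e) f) (suc-injective (trans s (sym t)))
      ... | e , inj₁ s | f , inj₁ t | _ , inj₂ _ =
        contradiction (subst (Adj I u) (injective (trans (sym f) e) (trans (sym t) s)) ux) ¬uv
      ... | e , inj₂ s | _ , inj₁ _ | f , inj₂ t =
        contradiction (subst (Adj I u) (injective (trans (sym f) e) (suc-injective (trans t (sym s)))) uy) ¬uv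
      ... | e , inj₁ s | _ , inj₂ _ | f , inj₁ t =
        contradiction (subst (Adj I u) (injective (trans (sym f) e) (trans (sym t) s)) uy) ¬uv
      ... | e , inj₂ s | f , inj₂ t | _ , inj₁ _ =
        contradiction (subst (Adj I u) (injective (trans (sym f) e) (suc-injective (trans t (sym s)))) ux) ¬uv

      -- No edge other than (u , v) leads from the sites up to u to those from v on.
      confined : ∀ {u v x y} → Adj F u v → suc (before P u) ≡ before P v → ¬ Adj I u v → SameFragment I x y →
                 frag P x ≡ frag P u → before P x ≤ before P u → before P y ≤ before P u
      confined uv s ¬uv ε e x≤u = x≤u
      confined {u} {v} {x} uv s ¬uv (_◅_ {j = z} xz zs) e x≤u with adj⇒ (I⊆F xz)
      ... | f , inj₂ t = confined uv s ¬uv zs (trans (sym f) e) (≤-trans (n≤1+n _) (≤-trans (≤-reflexive t) x≤u))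
      ... | f , inj₁ t with m≤n⇒m<n∨m≡n x≤u
      ...   | inj₁ x<u = confined uv s ¬uv zs (trans (sym f) e) (subst (_≤ before P u) t x<u)
      ...   | inj₂ x≡u = contradiction
        (subst₂ (Adj I) (injective e x≡u)
          (injective (trans (sym f) (trans e (proj₁ (adj⇒ uv)))) (trans (sym t) (trans (cong suc x≡u) s))) xz)
        ¬uv

      separate : suc (before P u) ≡ before P v ⊎ suc (before P v) ≡ before P u → ¬ SameFragment I u v
      separate (inj₁ s) uvs = 1+n≰n (≤-trans (≤-reflexive s) (confined uv s ¬uv uvs refl ≤-refl))
      separate (inj₂ s) uvs = 1+n≰n (≤-trans (≤-reflexive s)
        (confined (adj-sym uv) s (¬uv ∘ adj-sym) (Star.reverse adj-sym uvs) refl ≤-refl))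

  module _ .{{_ : NonZero n}} {P : Placement} {F : List (Edge {n})} (L : Layout P F)
           (single : ∀ u v → frag P u ≡ frag P v) where
    open Layout L

    private
      some : Fin n
      some = fromℕ< (ℕ.>-nonZero⁻¹ n)

      α ω : Fin n
      α = proj₁ (first L some)
      ω = proj₁ (last L some)

      α-first : before P α ≡ 0
      α-first = proj₂ (proj₂ (first L some))

      ω-last : after P ω ≡ 0
      ω-last = proj₂ (proj₂ (last L some))

      ≤ω : ∀ u → before P u ≤ before P ω
      ≤ω u = ≤-trans (m≤m+n _ (after P u)) (≤-reflexive
        (trans (size (single u ω)) (trans (cong (before P ω +_) ω-last) (+-identityʳ _))))

      -- The sites inject into the positions up to that of ω, which gives one inequality; `before<n`
      -- is the other.
      n≡ : n ≡ suc (before P ω)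
      n≡ = ≤-antisym
        (Fin.injective⇒≤ {f = λ u → fromℕ< (s≤s (≤ω u))} λ {u} {v} e → injective (single u v)
          (trans (sym (toℕ-fromℕ< (s≤s (≤ω u)))) (trans (cong toℕ e) (toℕ-fromℕ< (s≤s (≤ω v))))))
        (before<n L ω)

      site : ∀ i → ∃[ u ] frag P u ≡ frag P ω × before P u ≡ toℕ i
      site i = at L ω (ℕ.≤-pred (subst (toℕ i <_) n≡ (toℕ<n i)))

    -- The inverse of `before P`; the step from n - 1 back to 0 is then the closing edge (ω , α).
    tour : Fin n → Fin n
    tour i = proj₁ (site i)

    before-tour : ∀ i → before P (tour i) ≡ toℕ i
    before-tour i = proj₂ (proj₂ (site i))

    tour-at : ∀ {i u} → before P u ≡ toℕ i → tour i ≡ u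
    tour-at {i} {u} e = injective (single _ u) (trans (before-tour i) (sym e))

    tour-closes : Closes F tour
    tour-closes = record
      { bijective = injective′ , surjective
      ; u         = ω
      ; v         = α
      ; endpoints = λ w → mk⇔ (ends w) (endpoint w)
      ; edges     = λ x y → mk⇔ Sum.[ edge , adj-sym ∘ edge ] edge⁻
      }
      where
      injective′ : ∀ {i j} → tour i ≡ tour j → i ≡ j
      injective′ {i} {j} e = toℕ-injective (trans (sym (before-tour i)) (trans (cong (before P) e) (before-tour j)))

      surjective : ∀ u → ∃[ i ] ∀ {z} → z ≡ i → tour z ≡ u
      surjective u = fromℕ< (before<n L u) , λ { refl → tour-at (sym (toℕ-fromℕ< _)) }

      ends : ∀ w → Endpoint F w → w ≡ ω ⊎ w ≡ α
      ends w e with tip? P w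
      ... | yes (inj₁ z) = inj₂ (injective (single w α) (trans z (sym α-first)))
      ... | yes (inj₂ z) = inj₁ (injective-after L (single w ω) (trans z (sym ω-last)))
      ... | no ¬t with interior L ¬t
      ...   | x , y , x≢y , wx , wy = contradiction (e x y wx wy) x≢y

      endpoint : ∀ w → w ≡ ω ⊎ w ≡ α → Endpoint F w
      endpoint w (inj₁ refl) = tip⇒endpoint L (inj₂ ω-last)
      endpoint w (inj₂ refl) = tip⇒endpoint L (inj₁ α-first)

      before-next : ∀ i → before P (tour (suc (toℕ i) mod n)) ≡ suc (toℕ i) % n
      before-next i = trans (before-tour _) (toℕ-fromℕ< (m%n<n (suc (toℕ i)) n))

      edge : ∀ {x y} → TourEdge tour x y → Adj ((ω , α) ∷ F) x y
      edge (i , refl , refl) with m≤n⇒m<n∨m≡n (toℕ<n i)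
      ... | inj₁ si<n = adj-weaken (adj⇐ (single _ _)
        (trans (cong suc (before-tour i)) (sym (trans (before-next i) (m<n⇒m%n≡m si<n)))))
      -- The last position is that of ω, and its successor modulo n is 0, the position of α.
      ... | inj₂ si≡n = subst₂ (Adj ((ω , α) ∷ F))
        (sym (tour-at (suc-injective (trans (sym n≡) (sym si≡n)))))
        (injective (single α _) (trans α-first (sym (trans (before-next i) (trans (cong (_% n) si≡n) (n%n≡0 n))))))
        (inj₁ (here refl))

      step : ∀ {x y} → suc (before P x) ≡ before P y → TourEdge tour x y
      step {x} {y} s = i , tour-at (sym i≡) , tour-at (sym
        (trans (toℕ-fromℕ< (m%n<n (suc (toℕ i)) n)) (trans (cong (_% n) si≡) (m<n⇒m%n≡m (before<n L y)))))
        where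
        i = fromℕ< (before<n L x)
        i≡ : toℕ i ≡ before P x
        i≡ = toℕ-fromℕ< (before<n L x)
        si≡ : suc (toℕ i) ≡ before P y
        si≡ = trans (cong suc i≡) s

      wrap : TourEdge tour ω α
      wrap = i , tour-at (sym i≡) , tour-at (trans α-first (sym
        (trans (toℕ-fromℕ< (m%n<n (suc (toℕ i)) n)) (trans (cong (_% n) (trans (cong suc i≡) (sym n≡))) (n%n≡0 n)))))
        where
        i = fromℕ< (before<n L ω)
        i≡ : toℕ i ≡ before P ω
        i≡ = toℕ-fromℕ< (before<n L ω)

      old : ∀ {x y} → Adj F x y → TourEdge tour x y ⊎ TourEdge tour y x
      old xy = Sum.map step step (proj₂ (adj⇒ xy))

      edge⁻ : ∀ {x y} → Adj ((ω , α) ∷ F) x y → TourEdge tour x y ⊎ TourEdge tour y x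
      edge⁻ (inj₁ (here refl)) = inj₁ wrap
      edge⁻ (inj₂ (here refl)) = inj₂ wrap
      edge⁻ (inj₁ (there xy))  = old (inj₁ xy)
      edge⁻ (inj₂ (there xy))  = old (inj₂ xy)

module Outcome {n : ℕ} {c ℓ₁ ℓ₂} (D : Distances n c ℓ₁ ℓ₂) where
  open Distances D
  open Greedy D
  private module O = DecTotalOrder order
  open Placement

  module _ {P : Placement} {F : List (Edge {n})} (L : Layout P F)
           (single : ∀ u v → frag P u ≡ frag P v) (S : Settled P F) where
    open Layout L

    private
      -- Ties are broken in favour of the edges of F.
      rank : Edge {n} → ℕ
      rank (u , v) = if does (adj? F u v) then 0 else 1

      keyOrder : DecTotalOrder _ _ _
      keyOrder = On.decTotalOrder (×-decTotalOrder order ℕ.≤-decTotalOrder) (λ e → uncurry d e , rank e)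
      module K = DecTotalOrder keyOrder
      open Sort keyOrder using (sort; sort-↭; sort-↗)

      es₀ : List (Edge {n})
      es₀ = sort (allEdges n)

      es₀-unique : Unique es₀
      es₀-unique = Permutationₛ.AllPairs-resp-↭ (setoid _) (λ ne → ne ∘ sym) (subst₂ _≢_ refl , λ { refl → id })
        (↭⇒↭ₛ (↭-sym (sort-↭ (allEdges n)))) allEdges-unique

      K⇒≼ : ∀ {e f} → e K.≤ f → uncurry d e ≼ uncurry d f
      K⇒≼ (inj₁ (lt , _)) = lt
      K⇒≼ (inj₂ (eq , _)) = O.reflexive eq

      -- Among edges of equal length those of F have rank 0 and come first, so one that comes after
      -- an edge outside F is strictly longer.
      F-first : ∀ {u v x y} → ¬ Adj F u v → Adj F x y → (u , v) K.≤ (x , y) → ¬ d x y ≼ d u v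
      F-first {u} {v} {x} {y} ¬uv xy (inj₁ (lt , ne)) ge = ne (O.antisym lt ge)
      F-first {u} {v} {x} {y} ¬uv xy (inj₂ (_ , lt)) ge with adj? F u v | adj? F x y
      ... | yes uv | _      = ¬uv uv
      ... | no _   | no ¬xy = ¬xy xy
      F-first ¬uv xy (inj₂ (_ , ())) ge | no _ | yes _

      oriented : Edge {n} → Set
      oriented (u , v) = u Fin.< v

      blocked : ∀ {u v} → u Fin.< v → Blocked F u v
      blocked {u} {v} u<v with S u v (λ { refl → ℕ.<-irrefl refl u<v })
      ... | inj₁ b = b
      ... | inj₂ ((_ , _ , ne) , _) = contradiction (single u v) ne

      scan-all : ∀ es I → AllPairs K._≤_ es → Unique es → All oriented es →
                 (∀ {u v} → Adj I u v → Adj F u v) →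
                 (∀ {u v} → Adj F u v → Adj I u v ⊎ Adj es u v) →
                 (∀ {u v} → (u , v) ∈ es → ¬ Adj I u v) →
                 ∃[ G ] Scan es I G × (∀ {u v} → Adj G u v → Adj F u v) × (∀ {u v} → Adj F u v → Adj G u v)
      -- The scan always runs through the whole list: after the last edge of F the remaining edges
      -- are discarded one by one.
      scan-all [] I _ _ _ I⊆F F⊆ _ = I , done one , I⊆F , F⊆I
        where
        F⊆I : ∀ {u v} → Adj F u v → Adj I u v
        F⊆I uv with F⊆ uv
        ... | inj₁ uv′ = uv′
        ... | inj₂ (inj₁ ())
        ... | inj₂ (inj₂ ())
        one : OneFragment I
        one u v = Star.map F⊆I (connected (single u v))
      scan-all ((u , v) ∷ es) I (lt ∷ les) (ne ∷ nes) (u<v ∷ os) I⊆F F⊆ disj = go (adj? F u v)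
        where
        go : Dec (Adj F u v) →
             ∃[ G ] Scan ((u , v) ∷ es) I G × (∀ {x y} → Adj G x y → Adj F x y) × (∀ {x y} → Adj F x y → Adj G x y)
        go (yes uv) = map₂ (λ (s , r) → include (unused-joins L I⊆F uv (disj (here refl))) s , r)
          (scan-all es ((u , v) ∷ I) les nes os I⊆F′ F⊆′ disj′)
          where
          I⊆F′ : ∀ {x y} → Adj ((u , v) ∷ I) x y → Adj F x y
          I⊆F′ (inj₁ (here refl)) = uv
          I⊆F′ (inj₂ (here refl)) = adj-sym uv
          I⊆F′ (inj₁ (there xy))  = I⊆F (inj₁ xy)
          I⊆F′ (inj₂ (there xy))  = I⊆F (inj₂ xy)
          F⊆′ : ∀ {x y} → Adj F x y → Adj ((u , v) ∷ I) x y ⊎ Adj es x y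
          F⊆′ xy with F⊆ xy
          ... | inj₁ a                  = inj₁ (adj-weaken a)
          ... | inj₂ (inj₁ (here refl)) = inj₁ (inj₁ (here refl))
          ... | inj₂ (inj₂ (here refl)) = inj₁ (inj₂ (here refl))
          ... | inj₂ (inj₁ (there a))   = inj₂ (inj₁ a)
          ... | inj₂ (inj₂ (there a))   = inj₂ (inj₂ a)
          disj′ : ∀ {x y} → (x , y) ∈ es → ¬ Adj ((u , v) ∷ I) x y
          -- The list has no repetitions and all its edges lead upwards, so neither (u , v) nor its
          -- reverse occurs again.
          disj′ m (inj₁ (here refl)) = All.lookup ne m refl
          disj′ m (inj₂ (here refl)) = ℕ.<-asym u<v (All.lookup os m)
          disj′ m (inj₁ (there a))   = disj (there m) (inj₁ a)
          disj′ m (inj₂ (there a))   = disj (there m) (inj₂ a)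
        go (no ¬uv) = map₂ (λ (s , r) → discard (λ j → ¬joins j (blocked u<v)) s , r)
          (scan-all es I les nes os I⊆F F⊆′ (disj ∘ there))
          where
          F⊆′ : ∀ {x y} → Adj F x y → Adj I x y ⊎ Adj es x y
          F⊆′ xy with F⊆ xy
          ... | inj₁ a                  = inj₁ a
          ... | inj₂ (inj₁ (here refl)) = contradiction xy ¬uv
          ... | inj₂ (inj₂ (here refl)) = contradiction (adj-sym xy) ¬uv
          ... | inj₂ (inj₁ (there a))   = inj₂ (inj₁ a)
          ... | inj₂ (inj₂ (there a))   = inj₂ (inj₂ a)
          -- Edges of F still to come are strictly longer than (u , v), so whatever blocks it has
          -- been included already.
          near : ∀ {x y} → Near (d u v) F x y → Adj I x y
          near (xy , short) with F⊆′ xy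
          ... | inj₁ a        = a
          ... | inj₂ (inj₁ m) = contradiction short (F-first ¬uv xy (All.lookup lt m))
          ... | inj₂ (inj₂ m) = contradiction (d-swap short) (F-first ¬uv (adj-sym xy) (All.lookup lt m))
          ¬joins : Joins (u , v) I → ¬ Blocked F u v
          ¬joins (s , _ , _) (inj₁ (x , y , x≢y , a , b))        = x≢y (s x y (near a) (near b))
          ¬joins (_ , t , _) (inj₂ (inj₁ (x , y , x≢y , a , b))) = x≢y (t x y (near a) (near b))
          ¬joins (_ , _ , ne) (inj₂ (inj₂ ss))                   = ne (Star.map near ss)

      ∈-es₀ : ∀ {u v} → u ≢ v → Adj es₀ u v
      ∈-es₀ {u} {v} u≢v with Fin.<-cmp u v
      ... | tri< u<v _ _ = inj₁ (∈-resp-↭ (↭-sym (sort-↭ (allEdges n))) (∈-allEdges⁺ u<v))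
      ... | tri≈ _ u≡v _ = contradiction u≡v u≢v
      ... | tri> _ _ v<u = inj₂ (∈-resp-↭ (↭-sym (sort-↭ (allEdges n))) (∈-allEdges⁺ v<u))

    -- The equation on `before` lets the program output the tour by writing each site at its own
    -- position.
    outcome : .{{_ : NonZero n}} →
              ∃[ t ] MultipleFragment D t × (∀ i → before P (t i) ≡ toℕ i)
    outcome with scan-all es₀ [] (Sorted⇒AllPairs K.totalOrder (sort-↗ (allEdges n))) es₀-unique
      (All.tabulate (∈-allEdges⁻ ∘ ∈-resp-↭ (sort-↭ (allEdges n))))
      (λ { (inj₁ ()) ; (inj₂ ()) }) (λ uv → inj₂ (∈-es₀ λ { refl → layout-irrefl L uv }))
      (λ { _ (inj₁ ()) ; _ (inj₂ ()) })
    ... | G , scan , G⊆F , F⊆G = tour L′ single , record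
      { sequence = es₀
      ; complete = sort-↭ (allEdges n)
      ; sorted   = Linked.map⁺ (Linked.map K⇒≼ (sort-↗ (allEdges n)))
      ; included = G
      ; scan     = scan
      ; closes   = tour-closes L′ single
      } , before-tour L′ single
      where
      L′ : Layout P G
      L′ = layout-resp F⊆G G⊆F L

-- Nearest-neighbour chains

≔-same : ∀ {a} {A : Set a} (f : ℕ → A) x {v} → (f [ x ≔ v ]) x ≡ v
≔-same f x {v} = cong (λ b → if b then v else f x) (dec-true (x ℕ.≟ x) refl)

≔-other : ∀ {a} {A : Set a} (f : ℕ → A) {x y v} → x ≢ y → (f [ x ≔ v ]) y ≡ f y
≔-other f {x} {y} {v} x≢y = cong (λ b → if b then v else f y) (dec-false (x ℕ.≟ y) x≢y)

module _ {n : ℕ} where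
  open Placement

  isolated : Placement {n}
  isolated = record { frag = id ; before = λ _ → 0 ; after = λ _ → 0 }

  isolated-layout : Layout isolated []
  isolated-layout = record
    { frag-idem = λ _ → refl
    ; adj⇒      = λ { (inj₁ ()) ; (inj₂ ()) }
    ; adj⇐      = λ { _ () }
    ; connected = λ { refl → ε }
    ; injective = λ e _ → e
    ; size      = λ _ → refl
    ; pred      = λ ()
    ; succ      = λ ()
    }

  -- One site per fragment, the one it is named after, so that the cardinality counts the fragments.
  roots : Placement {n} → Subset n
  roots P = tabulate (λ u → does (frag P u ≟ u))

  ∈-roots⁺ : ∀ P {u} → frag P u ≡ u → u ∈ₛ roots P
  ∈-roots⁺ P {u} e = lookup⇒[]= u _ (trans (lookup∘tabulate _ u) (dec-true (frag P u ≟ u) e))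

  ∈-roots⁻ : ∀ P {u} → u ∈ₛ roots P → frag P u ≡ u
  ∈-roots⁻ P {u} m with frag P u ≟ u | trans (sym (lookup∘tabulate (λ u → does (frag P u ≟ u)) u)) ([]=⇒lookup m)
  ... | yes e | _ = e

  -- The site that names q's fragment ceases to be a name, and no site becomes one.
  merge-roots : ∀ {P F p q} → Layout P F → Valid P p q → ∣ roots (merge p q P) ∣ < ∣ roots P ∣
  merge-roots {P} {F} {p} {q} L v = p⊂q⇒∣p∣<∣q∣
    ( (λ {u} m → ∈-roots⁺ P (old u (∈-roots⁻ (merge p q P) m)))
    , frag P q , ∈-roots⁺ P (frag-idem q)
    , λ m → proj₂ (proj₂ v) (trans (sym (merge-frag-≡ P v (frag-idem q))) (∈-roots⁻ (merge p q P) m)))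
    where
    open Layout L
    old : ∀ u → frag (merge p q P) u ≡ u → frag P u ≡ u
    old u e with frag P u ≟ frag P q
    ... | no ne  = trans (sym (merge-frag-≢ P v ne)) e
    ... | yes eq = contradiction
      (trans (sym (trans (cong (frag P) (trans (sym e) (merge-frag-≡ P v eq))) (frag-idem p))) eq)
      (proj₂ (proj₂ v))

module Chains {n : ℕ} {c ℓ₁ ℓ₂} (D : Distances n c ℓ₁ ℓ₂) where
  open Distances D
  open Greedy D
  private module O = DecTotalOrder order
  open Placement

  -- A pair inside one fragment counts as infinitely long: it beats nothing. This lets the search
  -- start from (U 0 , V 0) when the chain has no edge.
  Beats : Placement → Fin n → Fin n → Fin n → Fin n → Set _
  Beats P p q x y = frag P p ≢ frag P q × d p q ≼ d x y

  -- The edges (U 1 , V 1), …, (U k , V k) lead from the fragment of V 0 through a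
  -- succession of distinct fragments, each of them followed by a nearest one.
  -- U 0 and V 0 are the same site, so that (U 0 , V 0) is never a valid edge.
  record Chain (P : Placement) (k : ℕ) (U V : ℕ → Fin n) : Set (c ⊔ ℓ₂) where
    field
      base       : U 0 ≡ V 0
      valid      : ∀ {i} → i < k → Valid P (U (suc i)) (V (suc i))
      link       : ∀ {i} → i < k → frag P (U (suc i)) ≡ frag P (V i)
      nearest    : ∀ {i} → i < k → ∀ {x y} → Valid P x y → frag P x ≡ frag P (V i) →
                   d (U (suc i)) (V (suc i)) ≼ d x y
      descending : ∀ {i j} → i ≤ j → j < k → d (U (suc j)) (V (suc j)) ≼ d (U (suc i)) (V (suc i))
      distinct   : ∀ {i j} → i < j → j ≤ k → frag P (V i) ≢ frag P (V j)

  module _ {P : Placement} {k : ℕ} {U V : ℕ → Fin n} (C : Chain P k U V) where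
    open Chain C

    -- V 0, ..., V k lie in k + 1 different fragments. This bounds the number of iterations and
    -- keeps the chain within its n cells.
    chain<n : k < n
    chain<n = Fin.injective⇒≤ {f = λ (i : Fin (suc k)) → frag P (V (toℕ i))} λ {i} {j} → inj i j
      where
      inj : (i j : Fin (suc k)) → frag P (V (toℕ i)) ≡ frag P (V (toℕ j)) → i ≡ j
      inj i j e with Fin.<-cmp i j
      ... | tri< i<j _ _ = contradiction e (distinct i<j (ℕ.≤-pred (toℕ<n j)))
      ... | tri≈ _ i≡j _ = i≡j
      ... | tri> _ _ j<i = contradiction (sym e) (distinct j<i (ℕ.≤-pred (toℕ<n i)))

    push : ∀ {p q} → Valid P p q → frag P p ≡ frag P (V k) → ¬ Beats P (U k) (V k) p q →
           (∀ {x y} → Valid P x y → frag P x ≡ frag P (V k) → d p q ≼ d x y) →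
           Chain P (suc k) (U [ suc k ≔ p ]) (V [ suc k ≔ q ])
    push {p} {q} pq p~ shorter near = record
      { base       = base
      ; valid      = valid′
      ; link       = link′
      ; nearest    = nearest′
      ; descending = descending′
      ; distinct   = distinct′
      }
      where
      U′ = U [ suc k ≔ p ]
      V′ = V [ suc k ≔ q ]

      U-old : ∀ {i} → i ≤ k → U′ i ≡ U i
      U-old i≤k = ≔-other U {suc k} λ { refl → 1+n≰n i≤k }
      V-old : ∀ {i} → i ≤ k → V′ i ≡ V i
      V-old i≤k = ≔-other V {suc k} λ { refl → 1+n≰n i≤k }
      U-new : U′ (suc k) ≡ p
      U-new = ≔-same U (suc k)
      V-new : V′ (suc k) ≡ q
      V-new = ≔-same V (suc k)

      -- The last edge of the chain is valid, so if it fails to beat (p , q) it is strictly longer;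
      -- the earlier edges are at least as long as the last.
      closer : ∀ {i} → i < k → d p q ≼ d (U (suc i)) (V (suc i)) × ¬ d (U (suc i)) (V (suc i)) ≼ d p q
      closer {i} i<k = go _ refl
        where
        go : ∀ j → k ≡ j → d p q ≼ d (U (suc i)) (V (suc i)) × ¬ d (U (suc i)) (V (suc i)) ≼ d p q
        go zero    refl = contradiction i<k λ ()
        go (suc j) refl = O.trans pq≼ ek≼ , ¬ge ∘ O.trans ek≼
          where
          ek≼ : d (U k) (V k) ≼ d (U (suc i)) (V (suc i))
          ek≼ = descending (ℕ.≤-pred i<k) ≤-refl
          ¬ge : ¬ d (U k) (V k) ≼ d p q
          ¬ge ge = shorter (proj₂ (proj₂ (valid ≤-refl)) , ge)
          pq≼ : d p q ≼ d (U k) (V k)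
          pq≼ = Sum.[ id , (λ ge → contradiction ge ¬ge) ] (O.total (d p q) (d (U k) (V k)))

      valid′ : ∀ {i} → i < suc k → Valid P (U′ (suc i)) (V′ (suc i))
      valid′ (s≤s i≤k) with m≤n⇒m<n∨m≡n i≤k
      ... | inj₁ i<k  = subst₂ (Valid P) (sym (U-old i<k)) (sym (V-old i<k)) (valid i<k)
      ... | inj₂ refl = subst₂ (Valid P) (sym U-new) (sym V-new) pq

      link′ : ∀ {i} → i < suc k → frag P (U′ (suc i)) ≡ frag P (V′ i)
      link′ (s≤s i≤k) with m≤n⇒m<n∨m≡n i≤k
      ... | inj₁ i<k  = trans (cong (frag P) (U-old i<k)) (trans (link i<k) (cong (frag P) (sym (V-old i≤k))))
      ... | inj₂ refl = trans (cong (frag P) U-new) (trans p~ (cong (frag P) (sym (V-old i≤k))))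

      nearest′ : ∀ {i} → i < suc k → ∀ {x y} → Valid P x y → frag P x ≡ frag P (V′ i) →
                 d (U′ (suc i)) (V′ (suc i)) ≼ d x y
      nearest′ (s≤s i≤k) {x} {y} v e with trans e (cong (frag P) (V-old i≤k)) | m≤n⇒m<n∨m≡n i≤k
      ... | e′ | inj₁ i<k  = subst₂ (λ s t → d s t ≼ d x y) (sym (U-old i<k)) (sym (V-old i<k)) (nearest i<k v e′)
      ... | e′ | inj₂ refl = subst₂ (λ s t → d s t ≼ d x y) (sym U-new) (sym V-new) (near v e′)

      descending′ : ∀ {i j} → i ≤ j → j < suc k → d (U′ (suc j)) (V′ (suc j)) ≼ d (U′ (suc i)) (V′ (suc i))
      descending′ i≤j (s≤s j≤k) with m≤n⇒m<n∨m≡n j≤k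
      ... | inj₁ j<k = subst₂ _≼_ (sym (cong₂ d (U-old j<k) (V-old j<k)))
        (sym (cong₂ d (U-old (≤-<-trans i≤j j<k)) (V-old (≤-<-trans i≤j j<k)))) (descending i≤j j<k)
      ... | inj₂ refl with m≤n⇒m<n∨m≡n i≤j
      ...   | inj₁ i<k = subst₂ _≼_ (sym (cong₂ d U-new V-new)) (sym (cong₂ d (U-old i<k) (V-old i<k))) (proj₁ (closer i<k))
      ...   | inj₂ refl = O.refl

      distinct′ : ∀ {i j} → i < j → j ≤ suc k → frag P (V′ i) ≢ frag P (V′ j)
      distinct′ {i} i<j j≤sk with m≤n⇒m<n∨m≡n j≤sk
      ... | inj₁ (s≤s j≤k) = subst₂ _≢_ (cong (frag P) (sym (V-old (≤-trans (<⇒≤ i<j) j≤k))))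
        (cong (frag P) (sym (V-old j≤k))) (distinct i<j j≤k)
      ... | inj₂ refl with m≤n⇒m<n∨m≡n (ℕ.≤-pred i<j)
      ...   | inj₂ refl = subst₂ _≢_ (cong (frag P) (sym (V-old ≤-refl))) (cong (frag P) (sym V-new))
        (λ e → proj₂ (proj₂ pq) (trans p~ e))
      -- If q lay in the fragment of an earlier `V i`, then (q , p) would be a valid edge there and
      -- shorter than the nearest one.
      ...   | inj₁ i<k = subst₂ _≢_ (cong (frag P) (sym (V-old (<⇒≤ i<k)))) (cong (frag P) (sym V-new))
        (λ e → proj₂ (closer i<k) (O.≤-respʳ-≈ (d-sym q p)
          (nearest i<k (proj₁ (proj₂ pq) , proj₁ pq , proj₂ (proj₂ pq) ∘ sym) (sym e))))

  module _ {P : Placement} {F} (L : Layout P F) {k : ℕ} {U V : ℕ → Fin n} (C : Chain P (suc k) U V) where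
    open Chain C
    private
      p = U (suc k)
      q = V (suc k)
      P′ = merge p q P

    top-valid : Valid P p q
    top-valid = valid ≤-refl

    private
      i≢p : ∀ {i} → i < k → frag P (V i) ≢ frag P p
      i≢p i<k e = distinct i<k (n≤1+n k) (trans e (link ≤-refl))

      i≢q : ∀ {i} → i < k → frag P (V i) ≢ frag P q
      i≢q i<k = distinct (≤-trans i<k (n≤1+n k)) ≤-refl

      -- `i < j` makes j positive, so the subtraction is not truncated.
      shrink : ∀ {i j} → i < j → j ≤ k ∸ 1 → j < k
      shrink {j = suc j} _ le′ = lemma k le′
        where
        lemma : ∀ k → suc j ≤ k ∸ 1 → suc j < k
        lemma (suc k) le″ = s≤s le″

    -- The fragments of V 0, ..., V (k - 1) take no part in the merge, so the edges between them
    -- stay valid and nearest. The edge to V k is given up. For k = 0 the chain restarts at V 0, now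
    -- inside the merged fragment.
    merge-chain : Chain P′ (k ∸ 1) U V
    merge-chain = record
      { base       = base
      ; valid      = λ i< → valid′ (shrink ≤-refl i<)
      ; link       = λ i< → merge-cong P top-valid (link (up (shrink ≤-refl i<)))
      ; nearest    = λ {i} i< v e → nearest (up (shrink ≤-refl i<)) (merge-valid⁻ P top-valid v)
                       (merge-frag⁻ P top-valid (i≢p (dn (shrink ≤-refl i<))) (i≢q (dn (shrink ≤-refl i<))) e)
      ; descending = λ i≤j j< → descending i≤j (up (shrink ≤-refl j<))
      ; distinct   = λ i<j j≤ e → distinct i<j (≤-trans (<⇒≤ (shrink i<j j≤)) (n≤1+n k))
                       (merge-frag⁻ P top-valid (i≢p (shrink i<j j≤)) (i≢q (shrink i<j j≤)) e)
      }
      where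
      up : ∀ {i} → suc i < k → i < suc k
      up i< = ≤-trans (n≤1+n _) (≤-trans i< (n≤1+n k))
      dn : ∀ {i} → suc i < k → i < k
      dn i< = ≤-trans (n≤1+n _) i<
      valid′ : ∀ {i} → suc i < k → Valid P′ (U (suc i)) (V (suc i))
      valid′ i< with valid (up i<)
      ... | s , t , ne = merge-tip P top-valid (i≢p (dn i<) ∘ trans (sym (link (up i<)))) (i≢q (dn i<) ∘ trans (sym (link (up i<)))) s
                       , merge-tip P top-valid (i≢p i<) (i≢q i<) t
                       , ne ∘ merge-frag⁻ P top-valid (i≢p i<) (i≢q i<)

  record Invariant (P : Placement) (F : List (Edge {n})) (k : ℕ) (U V : ℕ → Fin n) : Set (c ⊔ ℓ₂) where
    field
      layout  : Layout P F
      settled : Settled P F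
      chain   : Chain P k U V

  initially : ∀ u → Invariant isolated [] 0 (λ _ → u) (λ _ → u)
  initially u = record
    { layout  = isolated-layout
    ; settled = λ x y x≢y → inj₂ ((inj₁ refl , inj₁ refl , x≢y) , (λ { (inj₁ ()) ; (inj₂ ()) }) , λ { (inj₁ ()) ; (inj₂ ()) })
    ; chain   = record
      { base       = refl
      ; valid      = λ ()
      ; link       = λ ()
      ; nearest    = λ ()
      ; descending = λ { _ () }
      ; distinct   = λ { () z≤n }
      }
    }

  -- p , q is a shortest valid edge at the fragment of V k; it is the last edge
  -- of the chain unless it is strictly shorter.
  record Nearest (P : Placement) (k : ℕ) (U V : ℕ → Fin n) (p q : Fin n) : Set (c ⊔ ℓ₂) where
    field
      beats  : ∀ {x y} → Valid P x y → frag P x ≡ frag P (V k) → Beats P p q x y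
      origin : (p ≡ U k × q ≡ V k) ⊎
               (Valid P p q × frag P p ≡ frag P (V k) × ¬ Beats P (U k) (V k) p q)

  module _ {P F k U V p q} (I : Invariant P F k U V) (N : Nearest P k U V p q) where
    open Invariant I
    open Nearest N
    open Chain chain

    invariant-push : frag P q ≢ frag P (V k) → Invariant P F (suc k) (U [ suc k ≔ p ]) (V [ suc k ≔ q ])
    invariant-push ne with origin
    ... | inj₁ (_ , refl) = contradiction refl ne
    ... | inj₂ (v , e , sh) = record
      { layout  = layout
      ; settled = settled
      ; chain   = push chain v e sh (λ v e → proj₂ (beats v e))
      }

    -- Otherwise the first sites of two fragments would form a valid edge, which a pair inside one
    -- fragment does not beat.
    invariant-stop : frag P p ≡ frag P q → ∀ u → frag P u ≡ frag P (V k)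
    invariant-stop e u with frag P u ≟ frag P (V k)
    ... | yes f = f
    ... | no ne with first layout u | first layout (V k)
    ...   | x , f , s | y , g , t = contradiction e (proj₁ (beats {y} {x}
      (inj₁ t , inj₁ s , λ h → ne (trans (sym f) (trans (sym h) g))) g))

    -- A newly found edge starts in the fragment of `V k`, so it does not end there; and k is not 0,
    -- as U 0 and V 0 coincide.
    chain-top : frag P p ≢ frag P q → frag P q ≡ frag P (V k) → ∃[ k′ ] k ≡ suc k′ × p ≡ U k × q ≡ V k
    chain-top ne e with origin
    ... | inj₂ ((_ , _ , ne′) , f , _) = contradiction (trans f (sym e)) ne′
    chain-top ne e | inj₁ (refl , refl) = go k refl
      where
      go : ∀ j → k ≡ j → ∃[ k′ ] k ≡ suc k′ × U k ≡ U k × V k ≡ V k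
      go zero refl = contradiction (cong (frag P) base) ne
      go (suc j) eq = j , eq , refl , refl

    module _ (ne : frag P p ≢ frag P q) (e : frag P q ≡ frag P (V k)) where

      merging-valid : Valid P p q
      merging-valid with chain-top ne e
      ... | _ , refl , refl , refl = valid ≤-refl

      invariant-merge : Invariant (merge p q P) ((p , q) ∷ F) (k ∸ 2) U V
      invariant-merge with chain-top ne e
      ... | k′ , refl , refl , refl = record
        { layout  = merge-layout P merging-valid layout
        ; settled = merge-settled layout merging-valid
            -- At the fragment of p the edge is nearest because the chain chose it, at that of q
            -- because the search found nothing shorter.
            (λ { v (inj₁ f) → nearest ≤-refl v (trans f (link ≤-refl)) ; v (inj₂ f) → proj₂ (beats v f) }) settled
        ; chain   = merge-chain layout chain
        }

-- Running programs

private variable ℓ ℓ′ : Level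

-- Upper bounds on running times, valid as long as no loop is iterated more than 4 n times.
bound : ℕ → Program → ℕ
bound n skip           = 1
bound n (x := e)       = 1 + cost e
bound n (mem[ e ]:= f) = 1 + cost e + cost f
bound n (p ⨟ q)        = bound n p + bound n q
bound n (ifElse e p q) = 1 + cost e + (bound n p + bound n q)
bound n (while e p)    = 4 * n * (1 + cost e + bound n p) + (1 + cost e)

depth : Program → ℕ
depth skip           = 0
depth (x := e)       = 0
depth (mem[ e ]:= f) = 0
depth (p ⨟ q)        = depth p ℕ.⊔ depth q
depth (ifElse e p q) = depth p ℕ.⊔ depth q
depth (while e p)    = suc (depth p)

⊔-bound : ∀ n .{{_ : NonZero n}} i j a′ b′ {a b} → a ≤ a′ * n ^ i → b ≤ b′ * n ^ j →
          a + b ≤ (a′ + b′) * n ^ (i ℕ.⊔ j)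
⊔-bound n i j a′ b′ {a} {b} a≤ b≤ = begin
  a + b                                          ≤⟨ +-mono-≤ a≤ b≤ ⟩
  a′ * n ^ i + b′ * n ^ j                        ≤⟨ +-mono-≤ (*-monoʳ-≤ a′ (^-monoʳ-≤ n (m≤m⊔n i j)))
                                                             (*-monoʳ-≤ b′ (^-monoʳ-≤ n (m≤n⊔m i j))) ⟩
  a′ * n ^ (i ℕ.⊔ j) + b′ * n ^ (i ℕ.⊔ j)        ≡⟨ *-distribʳ-+ (n ^ (i ℕ.⊔ j)) a′ b′ ⟨
  (a′ + b′) * n ^ (i ℕ.⊔ j)                      ∎
  where open ≤-Reasoning

-- `bound n p` is a polynomial in n with natural coefficients, of degree at most `depth p`. Raising
-- every power of n to the highest one leaves the sum of the coefficients as a factor, which is the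
-- value at 1.
bound-poly : ∀ n .{{_ : NonZero n}} p → bound n p ≤ bound 1 p * n ^ depth p
bound-poly n skip           = ≤-refl
bound-poly n (x := e)       = ≤-reflexive (sym (*-identityʳ _))
bound-poly n (mem[ e ]:= f) = ≤-reflexive (sym (*-identityʳ _))
bound-poly n (p ⨟ q)        = ⊔-bound n (depth p) (depth q) (bound 1 p) (bound 1 q) (bound-poly n p) (bound-poly n q)
bound-poly n (ifElse e p q) = begin
  1 + cost e + (bound n p + bound n q)         ≤⟨ +-mono-≤ (m≤m*n (1 + cost e) N {{m^n≢0 n (depth p ℕ.⊔ depth q)}})
    (⊔-bound n (depth p) (depth q) (bound 1 p) (bound 1 q) (bound-poly n p) (bound-poly n q)) ⟩
  (1 + cost e) * N + (bound 1 p + bound 1 q) * N   ≡⟨ *-distribʳ-+ N (1 + cost e) (bound 1 p + bound 1 q) ⟨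
  (1 + cost e + (bound 1 p + bound 1 q)) * N       ∎
  where
  open ≤-Reasoning
  N = n ^ (depth p ℕ.⊔ depth q)
bound-poly n (while e p) = begin
  4 * n * (w + bound n p) + w                ≤⟨ +-mono-≤ (*-monoʳ-≤ (4 * n) inner) (m≤m*n w (n * N) {{m^n≢0 n (suc (depth p))}}) ⟩
  4 * n * ((w + bound 1 p) * N) + w * (n * N)
    ≡⟨ cong (_+ w * (n * N)) rearrange ⟩
  4 * 1 * (w + bound 1 p) * (n * N) + w * (n * N) ≡⟨ *-distribʳ-+ (n * N) (4 * 1 * (w + bound 1 p)) w ⟨
  (4 * 1 * (w + bound 1 p) + w) * (n * N)    ∎
  where
  open ≤-Reasoning
  w = 1 + cost e
  N = n ^ depth p
  rearrange : 4 * n * ((w + bound 1 p) * N) ≡ 4 * 1 * (w + bound 1 p) * (n * N)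
  rearrange = begin-equality
    4 * n * ((w + bound 1 p) * N)     ≡⟨ *-assoc 4 n _ ⟩
    4 * (n * ((w + bound 1 p) * N))   ≡⟨ cong (4 *_) (*-assoc n _ N) ⟨
    4 * (n * (w + bound 1 p) * N)     ≡⟨ cong (λ z → 4 * (z * N)) (*-comm n _) ⟩
    4 * ((w + bound 1 p) * n * N)     ≡⟨ cong (4 *_) (*-assoc (w + bound 1 p) n N) ⟩
    4 * ((w + bound 1 p) * (n * N))   ≡⟨ *-assoc 4 (w + bound 1 p) (n * N) ⟨
    4 * (w + bound 1 p) * (n * N)     ∎
  inner : w + bound n p ≤ (w + bound 1 p) * N
  inner = begin
    w + bound n p           ≤⟨ +-mono-≤ (m≤m*n w N {{m^n≢0 n (depth p)}}) (bound-poly n p) ⟩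
    w * N + bound 1 p * N   ≡⟨ *-distribʳ-+ N w (bound 1 p) ⟨
    (w + bound 1 p) * N     ∎

-- Array f occupies the cells f n, …, f n + n - 1; FROM and TO hold the edges of the chain.
pattern OUT    = zero
pattern FRAG   = suc zero
pattern BEFORE = suc (suc zero)
pattern AFTER  = suc (suc (suc zero))
pattern FROM   = suc (suc (suc (suc zero)))
pattern TO     = suc (suc (suc (suc (suc zero))))

-- These follow register 0, which holds n: register x has the number 1 + x.
pattern SITE  = zero
pattern SIZE  = suc zero
pattern BUSY  = suc (suc zero)
pattern HERE  = suc (suc (suc zero))
pattern BEST₁ = suc (suc (suc (suc zero)))
pattern BEST₂ = suc (suc (suc (suc (suc zero))))
pattern END₁  = suc (suc (suc (suc (suc (suc zero)))))
pattern END₂  = suc (suc (suc (suc (suc (suc (suc zero))))))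

infix 9 $_
$_ : Fin 8 → Expr
$ x = reg (suc (toℕ x))

infix 6 _←_
_←_ : Fin 8 → Expr → Program
x ← e = suc (toℕ x) := e

addr cell : Fin 6 → Expr → Expr
addr f e = add (times (lit (toℕ f)) (reg 0)) e
cell f e = mem (addr f e)

-- Flags are 0 or 1, so their product is a conjunction.
equal : Expr → Expr → Expr
equal e f = times (le e f) (le f e)

for : Program → Program
for p = SITE ← lit 0 ⨟ while (monus (reg 0) ($ SITE)) (p ⨟ SITE ← add ($ SITE) (lit 1))

-- A program logic for timed runs

module Execution {n : ℕ} .{{_ : NonZero n}} {c ℓ₁ ℓ₂} (D : Distances n c ℓ₁ ℓ₂) where
  open Distances D
  -- Since (2 + n) ^ 3 is at least 8, the fourth power exceeds every number below 8 (2 + n):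
  -- literals up to 15, addresses, and sums of two numbers up to n, even for the smallest n.
  W : ℕ
  W = (2 + n) ^ 4
  open Machine D W (6 * n) public

  small : ∀ {m} → m < 8 * (2 + n) → m < W
  small m< = ≤-trans m< (≤-trans (*-monoˡ-≤ (2 + n) (^-monoˡ-≤ 3 {2} {2 + n} (s≤s (s≤s z≤n))))
    (≤-reflexive (*-comm ((2 + n) ^ 3) (2 + n))))

  literal : ∀ {m} → m ≤ 15 → m < W
  literal m≤ = small (≤-trans (s≤s m≤) (*-monoʳ-≤ 8 (m≤m+n 2 n)))

  double : ∀ {m} → m ≤ n + n → m < W
  double {m} m≤ = small (begin-strict
    m             ≤⟨ m≤ ⟩
    n + n         ≡⟨ cong (n +_) (+-identityʳ n) ⟨
    2 * n         <⟨ *-monoʳ-< 2 (≤-trans (n<1+n n) (n≤1+n _)) ⟩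
    2 * (2 + n)   ≤⟨ *-monoˡ-≤ (2 + n) (s≤s (s≤s (z≤n {6}))) ⟩
    8 * (2 + n)   ∎)
    where open ≤-Reasoning

  product : ∀ {a b} → a ≤ n → b ≤ n → a * b < W
  product {a} {b} a≤ b≤ = begin-strict
    a * b                 ≤⟨ *-mono-≤ a≤ b≤ ⟩
    n * n                 <⟨ *-mono-< (≤-trans (n<1+n n) (n≤1+n _)) (≤-trans (n<1+n n) (n≤1+n _)) ⟩
    (2 + n) * (2 + n)     ≡⟨ cong ((2 + n) *_) (*-identityʳ (2 + n)) ⟨
    (2 + n) ^ 2           ≤⟨ ^-monoʳ-≤ (2 + n) {2} {4} (s≤s (s≤s z≤n)) ⟩
    (2 + n) ^ 4           ∎
    where open ≤-Reasoning

  address : Fin 6 → Fin n → ℕ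
  address f i = toℕ f * n + toℕ i

  address≡ : ∀ f i → address f i ≡ toℕ (combine f i)
  address≡ f i = trans (cong (_+ toℕ i) (*-comm (toℕ f) n)) (sym (toℕ-combine f i))

  address< : ∀ f i → address f i < 6 * n
  address< f i = subst (_< 6 * n) (sym (address≡ f i)) (toℕ<n (combine f i))

  address-injective : ∀ {f i g j} → address f i ≡ address g j → f ≡ g × i ≡ j
  address-injective {f} {i} {g} {j} e = combine-injective f i g j
    (toℕ-injective (trans (sym (address≡ f i)) (trans e (address≡ g j))))

  address<W : ∀ {m} → m < 6 * n → m < W
  address<W m< = small (≤-trans m< (*-mono-≤ {6} {8} (s≤s (s≤s (s≤s (s≤s (s≤s (s≤s z≤n)))))) (≤-trans (n≤1+n n) (n≤1+n _))))

  Registers Memory : Set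
  Registers = Vec ℕ 8
  Memory    = Fin 6 → Fin n → ℕ

  update : (Fin n → ℕ) → Fin n → ℕ → Fin n → ℕ
  update h i a j = if does (i ≟ j) then a else h j

  update-same : ∀ h i {a} → update h i a i ≡ a
  update-same h i {a} = cong (λ b → if b then a else h i) (dec-true (i ≟ i) refl)

  update-other : ∀ h {i j a} → i ≢ j → update h i a j ≡ h j
  update-other h {i} {j} {a} ne = cong (λ b → if b then a else h j) (dec-false (i ≟ j) ne)

  -- The arrays are compared first: for two concrete arrays the test evaluates, so a write to one
  -- leaves the others alone by computation.
  put : Memory → Fin 6 → Fin n → ℕ → Memory
  put μ f i a g = if does (f ≟ g) then update (μ g) i a else μ g

  put-same : ∀ μ f i {a} → put μ f i a f i ≡ a
  put-same μ f i {a} = trans (cong (λ b → (if b then update (μ f) i a else μ f) i) (dec-true (f ≟ f) refl))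
    (update-same (μ f) i)

  put-other : ∀ μ f {i j a} g → i ≢ j → put μ f i a g j ≡ μ g j
  put-other μ f g ne with f ≟ g
  ... | yes _ = update-other (μ g) ne
  ... | no _  = refl

  put-field : ∀ μ {f g} i j {a} → f ≢ g → put μ f i a g j ≡ μ g j
  put-field μ {f} {g} i j {a} ne = cong (λ b → (if b then update (μ g) i a else μ g) j) (dec-false (f ≟ g) ne)

  infix 4 _≈⟨_,_⟩
  -- All values tracked are numbers: the program compares distances at once and stores none.
  record _≈⟨_,_⟩ (s : State Distance) (w : Registers) (μ : Memory) : Set c where
    field
      sites : registers s 0 ≡ num n
      regs  : ∀ x → registers s (suc (toℕ x)) ≡ num (lookup w x)
      cells : ∀ f i → memory s (address f i) ≡ num (μ f i)
  open _≈⟨_,_⟩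

  ≈-resp : ∀ {s w μ ν} → (∀ f i → μ f i ≡ ν f i) → s ≈⟨ w , μ ⟩ → s ≈⟨ w , ν ⟩
  ≈-resp e R = record { sites = sites R ; regs = regs R ; cells = λ f i → trans (cells R f i) (cong num (e f i)) }

  Eval : Registers → Memory → Expr → ℕ → Set c
  Eval w μ e a = ∀ {s} → s ≈⟨ w , μ ⟩ → s ⊢ e ↦ num a

  module _ {w : Registers} {μ : Memory} where

    ⊢lit : ∀ {k} → k ≤ 15 → Eval w μ (lit k) k
    ⊢lit k≤ R = lit (literal k≤)

    ⊢n : Eval w μ (reg 0) n
    ⊢n {s} R = subst (s ⊢ reg 0 ↦_) (sites R) reg

    ⊢$ : ∀ x → Eval w μ ($ x) (lookup w x)
    ⊢$ x {s} R = subst (s ⊢ $ x ↦_) (regs R x) reg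

    ⊢cast : ∀ {e a b} → a ≡ b → Eval w μ e a → Eval w μ e b
    ⊢cast refl E = E

    ⊢addr : ∀ f {e i} → Eval w μ e (toℕ i) → Eval w μ (addr f e) (address f i)
    ⊢addr f {i = i} E R = add (times (lit (literal (≤-trans (<⇒≤ (toℕ<n f)) (m≤m+n 6 9)))) (⊢n R)
      (address<W (≤-<-trans (m≤m+n _ (toℕ i)) (address< f i)))) (E R) (address<W (address< f i))

    ⊢cell : ∀ f {e i} → Eval w μ e (toℕ i) → Eval w μ (cell f e) (μ f i)
    ⊢cell f {e} {i} E {s} R = subst (s ⊢ cell f e ↦_) (cells R f i) (mem (⊢addr f E R) (address< f i))

    ⊢add : ∀ {e f a b} → Eval w μ e a → Eval w μ f b → a + b ≤ n + n → Eval w μ (add e f) (a + b)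
    ⊢add E F a+b≤ R = add (E R) (F R) (double a+b≤)

    ⊢monus : ∀ {e f a b} → Eval w μ e a → Eval w μ f b → Eval w μ (monus e f) (a ∸ b)
    ⊢monus E F R = monus (E R) (F R)

    ⊢times : ∀ {e f a b} → Eval w μ e a → Eval w μ f b → a ≤ n → b ≤ n → Eval w μ (times e f) (a * b)
    ⊢times E F a≤ b≤ R = times (E R) (F R) (product a≤ b≤)

    Test : Expr → Set ℓ → Set (c ⊔ ℓ)
    Test e X = Σ[ x? ∈ Dec X ] Eval w μ e (if does x? then 1 else 0)

    ⊢le : ∀ {e f a b} → Eval w μ e a → Eval w μ f b → Test (le e f) (a ≤ b)
    ⊢le {a = a} {b} E F = (a ℕ.≤? b) , λ R → le-num (E R) (F R)

    ⊢le-dist : ∀ {e f g h i j k l} → Eval w μ e (toℕ i) → Eval w μ f (toℕ j) → Eval w μ g (toℕ k) →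
               Eval w μ h (toℕ l) → Test (le (dist e f) (dist g h)) (d i j ≼ d k l)
    ⊢le-dist {i = i} {j} {k} {l} E F G H = (d i j ≤? d k l) , λ R → le-dst (dist (E R) (F R)) (dist (G R) (H R))

    ⊢and : ∀ {e f} {X Y : Set ℓ} → Test e X → Test f Y → Test (times e f) (X × Y)
    ⊢and (x? , E) (y? , F) = (x? ×-dec y?) , λ R → subst (λ v → _ ⊢ _ ↦ num v) (flags (does x?) (does y?))
      (times (E R) (F R) (literal (≤-trans (flags≤1 (does x?) (does y?)) (s≤s z≤n))))
      where
      flags : ∀ x y → (if x then 1 else 0) * (if y then 1 else 0) ≡ (if x ∧ y then 1 else 0)
      flags false _     = refl
      flags true  false = refl
      flags true  true  = refl
      flags≤1 : ∀ x y → (if x then 1 else 0) * (if y then 1 else 0) ≤ 1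
      flags≤1 false _     = z≤n
      flags≤1 true  false = z≤n
      flags≤1 true  true  = ≤-refl

    ⊢equal : ∀ {e f a b} → Eval w μ e a → Eval w μ f b → Test (equal e f) (a ≡ b)
    ⊢equal E F with ⊢and (⊢le E F) (⊢le F E)
    ... | x? , G = Dec.map′ (uncurry ≤-antisym) (λ e → ≤-reflexive e , ≤-reflexive (sym e)) x? , G

  -- A Hoare triple for total correctness with the time bound built in, so that running times need
  -- no attention in the proofs about particular programs.
  record Run (p : Program) (w : Registers) (μ : Memory) (Post : Registers → Memory → Set ℓ) : Set (c ⊔ ℓ) where
    constructor running
    field
      run : ∀ {s} → s ≈⟨ w , μ ⟩ → Σ[ s′ ∈ State Distance ] ∃[ t ] ∃[ w′ ] ∃[ μ′ ]
              p , s ⇓[ t ] s′ × t ≤ bound n p × s′ ≈⟨ w′ , μ′ ⟩ × Post w′ μ′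
  open Run

  module _ {w : Registers} {μ : Memory} {Post : Registers → Memory → Set ℓ} where

    run-resp : ∀ {p ν} → (∀ f i → ν f i ≡ μ f i) → Run p w μ Post → Run p w ν Post
    run-resp e r = running λ R → run r (≈-resp e R)

    run-skip : Post w μ → Run skip w μ Post
    run-skip post = running λ R → _ , _ , _ , _ , skip , ≤-refl , R , post

    run-← : ∀ x {e a} → Eval w μ e a → Post (w [ x ]≔ a) μ → Run (x ← e) w μ Post
    run-← x {a = a} E post = running λ {s} R → _ , _ , _ , _ , assign (E R) , ≤-refl
      , record { sites = trans (≔-other (registers s) {suc (toℕ x)} {0} {num a} λ ()) (sites R)
               ; regs  = λ y → written R y
               ; cells = cells R } , post
      where
      written : ∀ {s} → s ≈⟨ w , μ ⟩ → ∀ y → (registers s [ suc (toℕ x) ≔ num a ]) (suc (toℕ y)) ≡ num (lookup (w [ x ]≔ a) y)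
      written {s} R y with x ≟ y
      ... | yes refl = trans (≔-same (registers s) (suc (toℕ x))) (cong num (sym (lookup∘update x w a)))
      ... | no ne    = trans (≔-other (registers s) (ne ∘ toℕ-injective ∘ ℕ.suc-injective))
        (trans (regs R y) (cong num (sym (lookup∘update′ (ne ∘ sym) w a))))

    run-store : ∀ f {e g i a} → Eval w μ e (toℕ i) → Eval w μ g a → Post w (put μ f i a) →
                Run (mem[ addr f e ]:= g) w μ Post
    run-store f {i = i} {a} E G post = running λ {s} R → _ , _ , _ , _
      , store (⊢addr f E R) (address< f i) (G R) , ≤-refl
      , record { sites = sites R ; regs = regs R ; cells = written R } , post
      where
      written : ∀ {s} → s ≈⟨ w , μ ⟩ → ∀ g j → (memory s [ address f i ≔ num a ]) (address g j) ≡ num (put μ f i a g j)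
      written {s} R g j = go (f ≟ g) (i ≟ j)
        where
        go : Dec (f ≡ g) → Dec (i ≡ j) → (memory s [ address f i ≔ num a ]) (address g j) ≡ num (put μ f i a g j)
        go (yes refl) (yes refl) = trans (≔-same (memory s) (address f i)) (cong num (sym (put-same μ f i)))
        go (yes refl) (no ne)    = trans (≔-other (memory s) (ne ∘ proj₂ ∘ address-injective {f} {i} {f} {j}))
          (trans (cells R f j) (cong num (sym (put-other μ f f ne))))
        go (no ne)    _          = trans (≔-other (memory s) (ne ∘ proj₁ ∘ address-injective {f} {i} {g} {j}))
          (trans (cells R g j) (cong num (sym (put-field μ i j ne))))

    run-if : ∀ {e p q} {X : Set ℓ′} → Test {w} {μ} e X → (X → Run p w μ Post) → (¬ X → Run q w μ Post) → Run (ifElse e p q) w μ Post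
    run-if (yes x , E) r r′ = running λ R → let s′ , t , w′ , μ′ , ex , t≤ , R′ , post = run (r x) R in
      s′ , _ , w′ , μ′ , then (E R) ex , +-monoʳ-≤ _ (≤-trans t≤ (m≤m+n _ _)) , R′ , post
    run-if (no ¬x , E) r r′ = running λ R → let s′ , t , w′ , μ′ , ex , t≤ , R′ , post = run (r′ ¬x) R in
      s′ , _ , w′ , μ′ , else (E R) ex , +-monoʳ-≤ _ (≤-trans t≤ (m≤n+m _ _)) , R′ , post

    run-if-≢0 : ∀ {e a p q} → Eval w μ e a → (∀ {b} → a ≡ suc b → Run p w μ Post) → (a ≡ 0 → Run q w μ Post) →
                Run (ifElse e p q) w μ Post
    run-if-≢0 {a = suc a} E r r′ = running λ R → let s′ , t , w′ , μ′ , ex , t≤ , R′ , post = run (r refl) R in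
      s′ , _ , w′ , μ′ , then (E R) ex , +-monoʳ-≤ _ (≤-trans t≤ (m≤m+n _ _)) , R′ , post
    run-if-≢0 {a = zero} E r r′ = running λ R → let s′ , t , w′ , μ′ , ex , t≤ , R′ , post = run (r′ refl) R in
      s′ , _ , w′ , μ′ , else (E R) ex , +-monoʳ-≤ _ (≤-trans t≤ (m≤n+m _ _)) , R′ , post

    run-seq : ∀ {p q} {Mid : Registers → Memory → Set ℓ′} →
              Run p w μ Mid → (∀ {w′ μ′} → Mid w′ μ′ → Run q w′ μ′ Post) → Run (p ⨟ q) w μ Post
    run-seq r r′ = running λ R →
      let _ , _ , _ , _ , ex , t≤ , R′ , mid = run r R
          s″ , _ , w″ , μ″ , ex′ , t′≤ , R″ , post = run (r′ mid) R′
      in s″ , _ , w″ , μ″ , seq ex ex′ , +-mono-≤ t≤ t′≤ , R″ , post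

  run-weaken : ∀ {p w μ} {Post : Registers → Memory → Set ℓ} {Post′ : Registers → Memory → Set ℓ′} →
               Run p w μ Post → (∀ {w′ μ′} → Post w′ μ′ → Post′ w′ μ′) → Run p w μ Post′
  run-weaken r f = running λ R → let s′ , t , w′ , μ′ , ex , t≤ , R′ , post = run r R in
    s′ , t , w′ , μ′ , ex , t≤ , R′ , f post

  module _ {w : Registers} {μ : Memory} {Post : Registers → Memory → Set ℓ} where

    run-←-seq : ∀ x {e a q} → Eval w μ e a → Run q (w [ x ]≔ a) μ Post → Run (x ← e ⨟ q) w μ Post
    run-←-seq x {a = a} E r = run-seq {Mid = λ w′ μ′ → w′ ≡ w [ x ]≔ a × μ′ ≡ μ} (run-← x E (refl , refl)) λ { (refl , refl) → r }

    run-store-seq : ∀ f {e g i a q} → Eval w μ e (toℕ i) → Eval w μ g a → Run q w (put μ f i a) Post →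
                    Run (mem[ addr f e ]:= g ⨟ q) w μ Post
    run-store-seq f {i = i} {a} E G r =
      run-seq {Mid = λ w′ μ′ → w′ ≡ w × μ′ ≡ put μ f i a} (run-store f E G (refl , refl)) λ { (refl , refl) → r }

  module _ {e p} {Post : Registers → Memory → Set ℓ} (I : ℕ → Registers → Memory → Set ℓ′)
           (step : ∀ {m w μ} → I m w μ → (Eval w μ e 0 × Post w μ) ⊎
                   (∃[ m′ ] ∃[ a ] m ≡ suc m′ × Eval w μ e (suc a) × Run p w μ (I m′))) where

    private
      iterate : ∀ m {w μ s} → I m w μ → s ≈⟨ w , μ ⟩ → Σ[ s′ ∈ State Distance ] ∃[ t ] ∃[ w′ ] ∃[ μ′ ]
                while e p , s ⇓[ t ] s′ × t ≤ m * (1 + cost e + bound n p) + (1 + cost e) × s′ ≈⟨ w′ , μ′ ⟩ × Post w′ μ′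
      iterate m i R with step i
      ... | inj₁ (E , post) = _ , _ , _ , _ , stop (E R) , m≤n+m _ _ , R , post
      ... | inj₂ (m′ , a , refl , E , r) =
        let _ , t , _ , _ , ex , t≤ , R′ , i′ = run r R
            s″ , t′ , w″ , μ″ , ex′ , t′≤ , R″ , post = iterate m′ i′ R′
        in s″ , _ , w″ , μ″ , loop (E R) ex ex′
         , ≤-trans (+-mono-≤ (+-monoʳ-≤ (1 + cost e) t≤) t′≤) (≤-reflexive (sym (+-assoc (1 + cost e + bound n p) _ _)))
         , R″ , post

    -- The index of the invariant is a budget of iterations: each of them spends one unit, and the
    -- loop may stop with some left. `bound` allows for a budget of 4 n.
    run-while : ∀ {m w μ} → I m w μ → m ≤ 4 * n → Run (while e p) w μ Post
    run-while {m} i m≤ = running λ R → let s′ , t , w′ , μ′ , ex , t≤ , R′ , post = iterate m i R in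
      s′ , t , w′ , μ′ , ex , ≤-trans t≤ (+-monoˡ-≤ (1 + cost e) (*-monoˡ-≤ (1 + cost e + bound n p) m≤)) , R′ , post

  run-for : ∀ {p y v μ} {Post : Registers → Memory → Set ℓ} (I : ℕ → Vec ℕ 7 → Memory → Set ℓ′) →
            (∀ i {v μ} → I (toℕ i) v μ →
              Run p (toℕ i ∷ v) μ (λ w′ μ′ → ∃[ v′ ] w′ ≡ toℕ i ∷ v′ × I (suc (toℕ i)) v′ μ′)) →
            I 0 v μ → (∀ {v′ μ′} → I n v′ μ′ → Post (n ∷ v′) μ′) → Run (for p) (y ∷ v) μ Post
  run-for {p = p} {y} {v} {μ} {Post} I body i₀ post =
    run-←-seq SITE (⊢lit z≤n) (run-while Left step {m = n} (0 , v , refl , refl , i₀) (m≤m+n n _))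
    where
    Left : ℕ → Registers → Memory → Set _
    Left m w μ = ∃[ j ] ∃[ v ] j + m ≡ n × w ≡ j ∷ v × I j v μ

    step : ∀ {m w μ} → Left m w μ → (Eval w μ (monus (reg 0) ($ SITE)) 0 × Post w μ) ⊎
           (∃[ m′ ] ∃[ a ] m ≡ suc m′ × Eval w μ (monus (reg 0) ($ SITE)) (suc a) ×
             Run (p ⨟ SITE ← add ($ SITE) (lit 1)) w μ (Left m′))
    step {zero} (j , v , e , refl , i) with refl ← trans (sym (+-identityʳ j)) e =
      inj₁ (⊢cast (n∸n≡0 n) (⊢monus ⊢n (⊢$ SITE)) , post i)
    step {suc m} (j , v , e , refl , i) = inj₂ (m , m , refl
      , ⊢cast (trans (cong (_∸ j) (sym e)) (m+n∸m≡n j (suc m))) (⊢monus ⊢n (⊢$ SITE))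
      , subst (λ k → Run _ (k ∷ v) _ (Left m)) j≡ (run-seq (body k (subst (λ k → I k v _) (sym j≡) i))
          λ { (v′ , refl , i′) → run-← SITE (⊢add (⊢$ SITE) (⊢lit (s≤s z≤n))
                (+-mono-≤ (<⇒≤ (toℕ<n k)) (ℕ.>-nonZero⁻¹ n)))
              (suc (toℕ k) , v′ , trans (cong (λ z → suc (z + m)) j≡) (trans (sym (+-suc j m)) e)
              , cong (_∷ v′) (+-comm (toℕ k) 1) , i′) }))
      where
      j<n : j < n
      j<n = ≤-trans (m≤m+n (suc j) m) (≤-reflexive (trans (sym (+-suc j m)) e))
      k : Fin n
      k = fromℕ< j<n
      j≡ : toℕ k ≡ j
      j≡ = toℕ-fromℕ< j<n

  -- The counter is left open, as every loop resets it.
  Mapped : Vec ℕ 7 → Memory → Registers → Memory → Set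
  Mapped v ν w μ = (∃[ y ] w ≡ y ∷ v) × (∀ f i → μ f i ≡ ν f i)

  run-mapped : ∀ {p q w μ v ν} {Post : Registers → Memory → Set ℓ} → Run p w μ (Mapped v ν) →
               (∀ y → Run q (y ∷ v) ν Post) → Run (p ⨟ q) w μ Post
  run-mapped r r′ = run-seq r λ { ((y , refl) , e) → run-resp e (r′ y) }

  -- Each iteration relies only on the old values at its own site and changes only cells of that
  -- site, so the sites below the counter are new and the others still old.
  run-map : ∀ {p y v μ} (new : Memory) →
            (∀ i {μ′} → (∀ f → μ′ f i ≡ μ f i) → Run p (toℕ i ∷ v) μ′ (λ w″ μ″ → w″ ≡ toℕ i ∷ v ×
              (∀ f → μ″ f i ≡ new f i) × (∀ f {j} → i ≢ j → μ″ f j ≡ μ′ f j))) →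
            Run (for p) (y ∷ v) μ (Mapped v new)
  run-map {p = p} {y} {v} {μ} new body =
    run-for I step (refl , (λ _ _ ()) , λ _ _ _ → refl) λ { (refl , done′ , _) → (n , refl) , λ f i → done′ f i (toℕ<n i) }
    where
    I : ℕ → Vec ℕ 7 → Memory → Set
    I j v′ μ′ = v′ ≡ v × (∀ f i → toℕ i < j → μ′ f i ≡ new f i) × (∀ f i → j ≤ toℕ i → μ′ f i ≡ μ f i)

    step : ∀ i {v′ μ′} → I (toℕ i) v′ μ′ →
           Run p (toℕ i ∷ v′) μ′ (λ w″ μ″ → ∃[ v″ ] w″ ≡ toℕ i ∷ v″ × I (suc (toℕ i)) v″ μ″)
    step i (refl , before , after) = run-weaken (body i (λ f → after f i ≤-refl)) λ { {_} {μ″} (refl , here′ , there′) →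
      v , refl , refl
      , (λ f j j≤i → Sum.[ (λ j<i → trans (there′ f (λ { refl → 1+n≰n j<i })) (before f j j<i))
                         , (λ j≡i → subst (λ k → μ″ f k ≡ new f k) (sym (toℕ-injective j≡i)) (here′ f)) ]
                         (m≤n⇒m<n∨m≡n (ℕ.≤-pred j≤i)))
      , (λ f j i<j → trans (there′ f (λ { refl → 1+n≰n i<j })) (after f j (<⇒≤ i<j))) }

-- The program

isolate : Program
isolate = for (mem[ addr FRAG ($ SITE) ]:= $ SITE)

-- Searching the ends anew in every iteration takes linear time and saves keeping them up to date.
findEnd : Fin 8 → Fin 6 → Program
findEnd x f = for (ifElse (times (equal (cell FRAG ($ SITE)) ($ HERE)) (le (cell f ($ SITE)) (lit 0)))
  (x ← $ SITE) skip)

-- A tie keeps the current edge, so the last edge of the chain gives way to strictly shorter ones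
-- only.
take try : Fin 8 → Program
take x = BEST₁ ← $ x ⨟ BEST₂ ← $ SITE
try x = ifElse (equal (cell FRAG ($ BEST₁)) (cell FRAG ($ BEST₂))) (take x)
  (ifElse (le (dist ($ BEST₁) ($ BEST₂)) (dist ($ x) ($ SITE))) skip (take x))

-- The product of the two positions vanishes exactly at the ends of fragments.
search : Program
search = for (ifElse (equal (cell FRAG ($ SITE)) ($ HERE)) skip
  (ifElse (times (cell BEFORE ($ SITE)) (cell AFTER ($ SITE))) skip (try END₁ ⨟ try END₂)))

-- Swaps the two numbers by way of their sum, without a register for a temporary value.
reversal : Fin 8 → Program
reversal x = for (ifElse (equal (cell FRAG ($ SITE)) ($ x))
  ( mem[ addr BEFORE ($ SITE) ]:= add (cell BEFORE ($ SITE)) (cell AFTER ($ SITE))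
  ⨟ mem[ addr AFTER ($ SITE) ]:= monus (cell BEFORE ($ SITE)) (cell AFTER ($ SITE))
  ⨟ mem[ addr BEFORE ($ SITE) ]:= monus (cell BEFORE ($ SITE)) (cell AFTER ($ SITE)))
  skip)

-- Here BEST₁ and BEST₂ hold the position of the first edge endpoint in its fragment and the
-- number of sites after the second one, and END₁ holds the name of the former fragment.
concatenation : Program
concatenation = for (ifElse (equal (cell FRAG ($ SITE)) ($ HERE))
  ( mem[ addr BEFORE ($ SITE) ]:= add (cell BEFORE ($ SITE)) (add ($ BEST₁) (lit 1))
  ⨟ mem[ addr FRAG ($ SITE) ]:= $ END₁)
  (ifElse (equal (cell FRAG ($ SITE)) ($ END₁))
    (mem[ addr AFTER ($ SITE) ]:= add (cell AFTER ($ SITE)) (add ($ BEST₂) (lit 1)))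
    skip))

mergeProgram pushProgram iteration output multipleFragment : Program
mergeProgram =
  END₁ ← cell FRAG ($ BEST₁) ⨟
  ifElse (cell AFTER ($ BEST₁)) (reversal END₁) skip ⨟
  ifElse (cell BEFORE ($ BEST₂)) (reversal HERE) skip ⨟
  BEST₁ ← cell BEFORE ($ BEST₁) ⨟
  BEST₂ ← cell AFTER ($ BEST₂) ⨟
  -- From a chain of a single edge, truncated subtraction returns to its start.
  SIZE ← monus ($ SIZE) (lit 2) ⨟
  concatenation

pushProgram =
  SIZE ← add ($ SIZE) (lit 1) ⨟
  mem[ addr FROM ($ SIZE) ]:= $ BEST₁ ⨟
  mem[ addr TO ($ SIZE) ]:= $ BEST₂

iteration =
  BEST₁ ← cell FROM ($ SIZE) ⨟
  BEST₂ ← cell TO ($ SIZE) ⨟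
  HERE ← cell FRAG ($ BEST₂) ⨟
  findEnd END₁ BEFORE ⨟
  findEnd END₂ AFTER ⨟
  search ⨟
  -- An edge newly found leaves the fragment HERE, so one that ends in it is the old end of the
  -- chain. If it begins there too, it is the degenerate (U 0 , V 0), and no valid edge exists.
  ifElse (equal (cell FRAG ($ BEST₂)) ($ HERE))
    (ifElse (equal (cell FRAG ($ BEST₁)) ($ HERE)) (BUSY ← lit 0) mergeProgram)
    pushProgram

output = for (mem[ addr OUT (cell BEFORE ($ SITE)) ]:= $ SITE)

multipleFragment = isolate ⨟ BUSY ← lit 1 ⨟ while ($ BUSY) iteration ⨟ output

-- Correctness of the program

module Correctness {n : ℕ} .{{_ : NonZero n}} {c ℓ₁ ℓ₂} (D : Distances n c ℓ₁ ℓ₂) where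
  open Distances D hiding (_≤?_)
  open Execution D
  open Greedy D
  open Chains D
  open Outcome D
  open Placement
  private module O = DecTotalOrder order

  -- FROM and TO also retain the entries beyond the end of the chain, so shortening the chain
  -- changes no cell.
  stored : Placement → (U V : ℕ → Fin n) → Memory
  stored P U V OUT    i = 0
  stored P U V FRAG   i = toℕ (frag P i)
  stored P U V BEFORE i = before P i
  stored P U V AFTER  i = after P i
  stored P U V FROM   i = toℕ (U (toℕ i))
  stored P U V TO     i = toℕ (V (toℕ i))

  -- Only z passes the test, so register x is written exactly once, when the counter reaches z.
  run-findEnd : ∀ x f {y v μ} {c z : Fin n} → lookup v (suc (suc zero)) ≡ toℕ c →
                lookup (v [ x ]≔ toℕ z) (suc (suc zero)) ≡ toℕ c →
                (∀ i → μ FRAG i ≡ toℕ c → μ f i ≡ 0 → i ≡ z) → μ FRAG z ≡ toℕ c → μ f z ≡ 0 →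
                Run (findEnd (suc x) f) (y ∷ v) μ (λ w′ μ′ → w′ ≡ n ∷ v [ x ]≔ toℕ z × μ′ ≡ μ)
  run-findEnd x f {y} {v} {μ} {c} {z} v≡ v′≡ unique z∈ z-end =
    run-for I step (refl , inj₂ (z≤n , refl)) final
    where
    I : ℕ → Vec ℕ 7 → Memory → Set
    I j v′ μ′ = μ′ ≡ μ × ((toℕ z < j × v′ ≡ v [ x ]≔ toℕ z) ⊎ (j ≤ toℕ z × v′ ≡ v))

    final : ∀ {v′ μ′} → I n v′ μ′ → n ∷ v′ ≡ n ∷ v [ x ]≔ toℕ z × μ′ ≡ μ
    final (e , inj₁ (_ , refl)) = refl , e
    final (e , inj₂ (n≤z , _))  = contradiction (toℕ<n z) (≤⇒≯ n≤z)

    step : ∀ i {v′ μ′} → I (toℕ i) v′ μ′ → Run _ (toℕ i ∷ v′) μ′ (λ w″ μ″ → ∃[ v″ ] w″ ≡ toℕ i ∷ v″ × I (suc (toℕ i)) v″ μ″)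
    step i {v′} (refl , s) = run-if
      (⊢and (⊢equal (⊢cell FRAG (⊢$ SITE)) (⊢cast (here-reg s) (⊢$ HERE))) (⊢le (⊢cell f (⊢$ SITE)) (⊢lit z≤n)))
      (λ (e , e′) → run-← (suc x) (⊢$ SITE) (_ , refl , refl , found (unique i e (n≤0⇒n≡0 e′)) s))
      (λ ¬e → run-skip (_ , refl , refl , elsewhere (λ { refl → ¬e (z∈ , ≤-reflexive z-end) }) s))
      where
      State′ : ℕ → Set
      State′ j = (toℕ z < j × v′ ≡ v [ x ]≔ toℕ z) ⊎ (j ≤ toℕ z × v′ ≡ v)
      here-reg : State′ (toℕ i) → lookup v′ (suc (suc zero)) ≡ toℕ c
      here-reg (inj₁ (_ , refl)) = v′≡
      here-reg (inj₂ (_ , refl)) = v≡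
      found : i ≡ z → State′ (toℕ i) →
              (toℕ z < suc (toℕ i) × v′ [ x ]≔ toℕ i ≡ v [ x ]≔ toℕ z) ⊎ (suc (toℕ i) ≤ toℕ z × v′ [ x ]≔ toℕ i ≡ v)
      found refl (inj₁ (i<i , _)) = contradiction i<i 1+n≰n
      found refl (inj₂ (_ , refl)) = inj₁ (≤-refl , refl)
      elsewhere : i ≢ z → State′ (toℕ i) → State′ (suc (toℕ i))
      elsewhere ne (inj₁ (z<i , e)) = inj₁ (≤-trans z<i (n≤1+n _) , e)
      elsewhere ne (inj₂ (i≤z , e)) = inj₂ (≤∧≢⇒< i≤z (ne ∘ toℕ-injective) , e)

  module _ (P : Placement {n}) (U V : ℕ → Fin n) where

    run-try : ∀ x {y k r h a b} {p q z : Fin n} →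
              let w : Fin n → Fin n → Registers
                  w p q = toℕ y ∷ k ∷ r ∷ h ∷ toℕ p ∷ toℕ q ∷ a ∷ b ∷ []
              in lookup (w p q) x ≡ toℕ z → frag P z ≢ frag P y →
              Run (try x) (w p q) (stored P U V) (λ w′ μ′ → μ′ ≡ stored P U V ×
                ∃[ p′ ] ∃[ q′ ] w′ ≡ w p′ q′ × Beats P p′ q′ z y ×
                (∀ {s t} → Beats P p q s t → Beats P p′ q′ s t) ×
                ((p′ ≡ p × q′ ≡ q) ⊎ (p′ ≡ z × q′ ≡ y × ¬ Beats P p q z y)))
    run-try x {y} {p = p} {q} {z} z-reg z≁y = run-if (⊢equal (⊢cell FRAG (⊢$ BEST₁)) (⊢cell FRAG (⊢$ BEST₂)))
      (λ e → run-←-seq BEST₁ (⊢cast z-reg (⊢$ x)) (run-← BEST₂ (⊢$ SITE) (refl , z , y , refl , (z≁y , O.refl)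
        , (λ (ne , _) → contradiction (toℕ-injective e) ne) , inj₂ (refl , refl , λ (ne , _) → ne (toℕ-injective e)))))
      (λ ne → run-if (⊢le-dist {i = p} {q} {z} {y} (⊢$ BEST₁) (⊢$ BEST₂) (⊢cast z-reg (⊢$ x)) (⊢$ SITE))
        (λ le′ → run-skip (refl , p , q , refl , (ne ∘ cong toℕ , le′) , id , inj₁ (refl , refl)))
        (λ ¬le → run-←-seq BEST₁ (⊢cast z-reg (⊢$ x)) (run-← BEST₂ (⊢$ SITE) (refl , z , y , refl , (z≁y , O.refl)
          , (λ (_ , le′) → z≁y , O.trans (Sum.[ (λ l → contradiction l ¬le) , id ] (O.total (d p q) (d z y))) le′)
          , inj₂ (refl , refl , ¬le ∘ proj₂)))))

    -- A valid edge at the fragment of `V k` starts at one of its ends, so it is enough to try a and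
    -- b against every end outside.
    run-search : ∀ {F k} → Layout P F → ∀ {y κ r} {a b : Fin n} →
                 frag P a ≡ frag P (V k) → before P a ≡ 0 → frag P b ≡ frag P (V k) → after P b ≡ 0 →
                 let w : ℕ → Fin n → Fin n → Registers
                     w y p q = y ∷ κ ∷ r ∷ toℕ (frag P (V k)) ∷ toℕ p ∷ toℕ q ∷ toℕ a ∷ toℕ b ∷ []
                 in Run search (w y (U k) (V k)) (stored P U V) (λ w′ μ′ → μ′ ≡ stored P U V ×
                      ∃[ p ] ∃[ q ] w′ ≡ w n p q × Nearest P k U V p q)
    run-search {k = k} L {y} {κ} {r} {a} {b} a~ a-first b~ b-last =
      run-for I step (refl , U k , V k , refl , id , (λ _ ()) , inj₁ (refl , refl)) final
      where
      v : Fin n → Fin n → Vec ℕ 7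
      v p q = κ ∷ r ∷ toℕ (frag P (V k)) ∷ toℕ p ∷ toℕ q ∷ toℕ a ∷ toℕ b ∷ []

      Origin : Fin n → Fin n → Set _
      Origin p q = (p ≡ U k × q ≡ V k) ⊎ (Valid P p q × frag P p ≡ frag P (V k) × ¬ Beats P (U k) (V k) p q)

      I : ℕ → Vec ℕ 7 → Memory → Set _
      I j v′ μ′ = μ′ ≡ stored P U V × ∃[ p ] ∃[ q ] v′ ≡ v p q ×
        (∀ {s t} → Beats P (U k) (V k) s t → Beats P p q s t) ×
        (∀ y → toℕ y < j → Tip P y → frag P y ≢ frag P (V k) → Beats P p q a y × Beats P p q b y) ×
        Origin p q

      a-tip : Tip P a
      a-tip = inj₁ a-first

      b-tip : Tip P b
      b-tip = inj₂ b-last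

      next : ∀ {X : Fin n → Set ℓ₂} {i} → (∀ y → toℕ y < toℕ i → X y) → X i → ∀ y → toℕ y < suc (toℕ i) → X y
      next {X} old new y y≤i = Sum.[ old y , (λ e → subst X (sym (toℕ-injective e)) new) ] (m≤n⇒m<n∨m≡n (ℕ.≤-pred y≤i))

      origin′ : ∀ {p q p′ q′ z i} → Tip P z → Tip P i → frag P z ≡ frag P (V k) → frag P z ≢ frag P i →
                (∀ {s t} → Beats P (U k) (V k) s t → Beats P p q s t) → Origin p q →
                (p′ ≡ p × q′ ≡ q) ⊎ (p′ ≡ z × q′ ≡ i × ¬ Beats P p q z i) → Origin p′ q′
      origin′ _ _ _ _ _ o (inj₁ (refl , refl)) = o
      origin′ tz ti z~ z≁i mono _ (inj₂ (refl , refl , ¬b)) = inj₂ ((tz , ti , z≁i) , z~ , ¬b ∘ mono)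

      step : ∀ i {v′ μ′} → I (toℕ i) v′ μ′ → Run _ (toℕ i ∷ v′) μ′ (λ w″ μ″ → ∃[ v″ ] w″ ≡ toℕ i ∷ v″ × I (suc (toℕ i)) v″ μ″)
      step i (refl , p , q , refl , mono , best , o) = run-if (⊢equal (⊢cell FRAG (⊢$ SITE)) (⊢$ HERE))
        (λ e → run-skip (_ , refl , refl , p , q , refl , mono
          , next best (λ _ ne → contradiction (toℕ-injective e) ne) , o))
        (λ ne → run-if-≢0 (⊢times (⊢cell BEFORE (⊢$ SITE)) (⊢cell AFTER (⊢$ SITE)) (<⇒≤ (before<n L i)) (<⇒≤ (after<n L i)))
          (λ {m} e → run-skip (_ , refl , refl , p , q , refl , mono
            , next best (λ t → contradiction (trans (sym e) (interior≡0 t)) λ ()) , o))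
          (λ e → let ti = m*n≡0⇒m≡0∨n≡0 (before P i) e
                     a≁ = λ f → ne (cong toℕ (trans (sym f) a~))
                     b≁ = λ f → ne (cong toℕ (trans (sym f) b~))
                 in run-seq (run-try END₁ {z = a} refl a≁) λ { (refl , p′ , q′ , refl , beats , mono′ , o′) →
                    run-weaken (run-try END₂ {z = b} refl b≁) λ { (refl , p″ , q″ , refl , beats′ , mono″ , o″) →
                      _ , refl , refl , p″ , q″ , refl , mono″ ∘ mono′ ∘ mono
                      , next (λ y lt t f → let g , h = best y lt t f in mono″ (mono′ g) , mono″ (mono′ h))
                             (λ _ _ → mono″ beats , beats′)
                      , origin′ b-tip ti b~ b≁ (mono′ ∘ mono) (origin′ a-tip ti a~ a≁ mono o o′) o″ } }))
        where
        interior≡0 : Tip P i → before P i * after P i ≡ 0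
        interior≡0 (inj₁ z) = cong (_* after P i) z
        interior≡0 (inj₂ z) = trans (cong (before P i *_) z) (*-zeroʳ (before P i))

      final : ∀ {v′ μ′} → I n v′ μ′ → μ′ ≡ stored P U V × ∃[ p ] ∃[ q ] n ∷ v′ ≡ n ∷ v p q × Nearest P k U V p q
      final (e , p , q , refl , mono , best , o) = e , p , q , refl , record { beats = beats ; origin = o }
        where
        beats : ∀ {x y} → Valid P x y → frag P x ≡ frag P (V k) → Beats P p q x y
        beats {x} {y} (tx , ty , ne) e with best y (toℕ<n y) ty (λ f → ne (trans e (sym f)))
        ... | g , h = Sum.[ (λ z → subst (λ x → Beats P p q x y) (Layout.injective L (trans a~ (sym e)) (trans a-first (sym z))) g)
                          , (λ z → subst (λ x → Beats P p q x y) (injective-after L (trans b~ (sym e)) (trans b-last (sym z))) h) ] tx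

  module _ (U V : ℕ → Fin n) where

    run-reversal : ∀ {P F} → Layout P F → ∀ x {y v} {h : Fin n} → lookup v x ≡ toℕ h →
                   Run (reversal (suc x)) (y ∷ v) (stored P U V) (Mapped v (stored (flip h P) U V))
    run-reversal {P} L x {y} {v} {h} x-reg = run-map (stored (flip h P) U V) body
      where
      new = stored (flip h P) U V
      body : ∀ i {μ} → (∀ f → μ f i ≡ stored P U V f i) → Run _ (toℕ i ∷ v) μ (λ w″ μ″ → w″ ≡ toℕ i ∷ v ×
             (∀ f → μ″ f i ≡ new f i) × (∀ f {j} → i ≢ j → μ″ f j ≡ μ f j))
      body i {μ} eq = run-if (⊢equal (⊢cast (eq FRAG) (⊢cell FRAG (⊢$ SITE))) (⊢cast x-reg (⊢$ (suc x))))
        (λ e → run-store-seq BEFORE (⊢$ SITE) sum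
             (run-store-seq AFTER (⊢$ SITE) (⊢cast (m+n∸n≡m b a) difference₁)
             (run-store BEFORE (⊢$ SITE) (⊢cast (m+n∸m≡n b a) difference₂)
             (refl , stored-at (toℕ-injective e) , elsewhere))))
        (λ ne → run-skip (refl , unchanged (ne ∘ cong toℕ) , λ _ _ → refl))
        where
        a = after P i
        b = before P i
        μ₁ = put μ BEFORE i (b + a)
        μ₂ = put μ₁ AFTER i b
        μ₃ = put μ₂ BEFORE i a
        sum : Eval (toℕ i ∷ v) μ (add (cell BEFORE ($ SITE)) (cell AFTER ($ SITE))) (b + a)
        sum = ⊢add (⊢cast (eq BEFORE) (⊢cell BEFORE (⊢$ SITE))) (⊢cast (eq AFTER) (⊢cell AFTER (⊢$ SITE)))
          (≤-trans (<⇒≤ (size<n L i)) (m≤m+n n n))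
        difference₁ : Eval (toℕ i ∷ v) μ₁ (monus (cell BEFORE ($ SITE)) (cell AFTER ($ SITE))) (b + a ∸ a)
        difference₁ = ⊢monus (⊢cast (update-same (μ BEFORE) i) (⊢cell BEFORE (⊢$ SITE)))
          (⊢cast (eq AFTER) (⊢cell AFTER (⊢$ SITE)))
        difference₂ : Eval (toℕ i ∷ v) μ₂ (monus (cell BEFORE ($ SITE)) (cell AFTER ($ SITE))) (b + a ∸ b)
        difference₂ = ⊢monus (⊢cast (update-same (μ BEFORE) i) (⊢cell BEFORE (⊢$ SITE)))
          (⊢cast (update-same (μ AFTER) i) (⊢cell AFTER (⊢$ SITE)))
        stored-at : frag P i ≡ h → ∀ f → μ₃ f i ≡ new f i
        stored-at e OUT    = eq OUT
        stored-at e FRAG   = eq FRAG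
        stored-at e BEFORE = trans (update-same (μ₂ BEFORE) i) (sym (flip-before h P e))
        stored-at e AFTER  = trans (update-same (μ₁ AFTER) i) (sym (flip-after h P e))
        stored-at e FROM   = eq FROM
        stored-at e TO     = eq TO
        unchanged : frag P i ≢ h → ∀ f → μ f i ≡ new f i
        unchanged ne OUT    = eq OUT
        unchanged ne FRAG   = eq FRAG
        unchanged ne BEFORE = trans (eq BEFORE) (sym (flip-before-≢ h P ne))
        unchanged ne AFTER  = trans (eq AFTER) (sym (flip-after-≢ h P ne))
        unchanged ne FROM   = eq FROM
        unchanged ne TO     = eq TO
        elsewhere : ∀ f {j} → i ≢ j → μ₃ f j ≡ μ f j
        elsewhere f ne = trans (put-other μ₂ BEFORE f ne) (trans (put-other μ₁ AFTER f ne) (put-other μ BEFORE f ne))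

    run-turn : ∀ {P F} → Layout P F → ∀ m {e} x {y v} {h : Fin n} → lookup v x ≡ toℕ h →
               Eval (y ∷ v) (stored P U V) e m →
               Run (ifElse e (reversal (suc x)) skip) (y ∷ v) (stored P U V) (Mapped v (stored (turn (m ℕ.≡ᵇ 0) h P) U V))
    run-turn L m x x-reg E = run-if-≢0 E (λ { refl → run-reversal L x x-reg }) (λ { refl → run-skip ((_ , refl) , λ _ _ → refl) })

    run-concatenation : ∀ {P F p q} → Layout P F → frag P p ≢ frag P q → ∀ {y k r b} →
      let v : Vec ℕ 7
          v = k ∷ r ∷ toℕ (frag P q) ∷ before P p ∷ after P q ∷ toℕ (frag P p) ∷ b ∷ []
      in Run concatenation (y ∷ v) (stored P U V) (Mapped v (stored (join p q P) U V))
    run-concatenation {P} {F} {p} {q} L p≁q {y} {k} {r} {b} = run-map new body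
      where
      v : Vec ℕ 7
      v = k ∷ r ∷ toℕ (frag P q) ∷ before P p ∷ after P q ∷ toℕ (frag P p) ∷ b ∷ []
      new = stored (join p q P) U V

      sum : ∀ {l m i} {e e′} {w μ} → l < n → m < n → Eval w μ e l → Eval w μ e′ m →
            Eval w μ (add e (add e′ (lit 1))) (l + (m + 1))
      sum {l} {m} l< m< E E′ = ⊢add E (⊢add E′ (⊢lit (s≤s z≤n)) (≤-trans m+1≤ (m≤m+n n n))) (+-mono-≤ (<⇒≤ l<) m+1≤)
        where
        m+1≤ : m + 1 ≤ n
        m+1≤ = ≤-trans (≤-reflexive (+-comm m 1)) m<

      body : ∀ i {μ} → (∀ f → μ f i ≡ stored P U V f i) → Run _ (toℕ i ∷ v) μ (λ w″ μ″ → w″ ≡ toℕ i ∷ v ×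
             (∀ f → μ″ f i ≡ new f i) × (∀ f {j} → i ≢ j → μ″ f j ≡ μ f j))
      body i {μ} eq = run-if (⊢equal (⊢cast (eq FRAG) (⊢cell FRAG (⊢$ SITE))) (⊢$ HERE))
        (λ e → run-store-seq BEFORE (⊢$ SITE)
                 (sum {i = i} (before<n L i) (before<n L p) (⊢cast (eq BEFORE) (⊢cell BEFORE (⊢$ SITE))) (⊢$ BEST₁))
                 (run-store FRAG (⊢$ SITE) (⊢$ END₁) (refl , in-right (toℕ-injective e)
                 , λ f ne → trans (put-other (put μ BEFORE i (before P i + (before P p + 1))) FRAG f ne) (put-other μ BEFORE f ne))))
        (λ ne → run-if (⊢equal (⊢cast (eq FRAG) (⊢cell FRAG (⊢$ SITE))) (⊢$ END₁))
          (λ e → run-store AFTER (⊢$ SITE)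
                   (sum {i = i} (after<n L i) (after<n L q) (⊢cast (eq AFTER) (⊢cell AFTER (⊢$ SITE))) (⊢$ BEST₂))
                   (refl , in-left (toℕ-injective e) , λ f ne → put-other μ AFTER f ne))
          (λ ne′ → run-skip (refl , in-neither (ne ∘ cong toℕ) (ne′ ∘ cong toℕ) , λ _ _ → refl)))
        where
        μᴿ = put (put μ BEFORE i (before P i + (before P p + 1))) FRAG i (toℕ (frag P p))
        μᴸ = put μ AFTER i (after P i + (after P q + 1))
        in-right : frag P i ≡ frag P q → ∀ f → μᴿ f i ≡ new f i
        in-right e f with side p q P p≁q i
        ... | left e′ _ _ _     = contradiction (trans (sym e′) e) p≁q
        ... | other _ ne _ _ _  = contradiction e ne
        in-right e OUT    | right _ _ _ _  = eq OUT
        in-right e FRAG   | right _ f′ _ _ = trans (update-same (μ FRAG) i) (cong toℕ (sym f′))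
        in-right e BEFORE | right _ _ b′ _ =
          trans (update-same (μ BEFORE) i) (trans (cong (before P i +_) (+-comm _ 1)) (sym b′))
        in-right e AFTER  | right _ _ _ a′ = trans (eq AFTER) (sym a′)
        in-right e FROM   | right _ _ _ _  = eq FROM
        in-right e TO     | right _ _ _ _  = eq TO
        in-left : frag P i ≡ frag P p → ∀ f → μᴸ f i ≡ new f i
        in-left e f with side p q P p≁q i
        ... | right e′ _ _ _   = contradiction (trans (sym e) e′) p≁q
        ... | other ne _ _ _ _ = contradiction e ne
        in-left e OUT    | left _ _ _ _  = eq OUT
        in-left e FRAG   | left _ f′ _ _ = trans (eq FRAG) (cong toℕ (trans e (sym f′)))
        in-left e BEFORE | left _ _ b′ _ = trans (eq BEFORE) (sym b′)
        in-left e AFTER  | left _ _ _ a′ =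
          trans (update-same (μ AFTER) i) (trans (cong (after P i +_) (+-comm _ 1)) (sym a′))
        in-left e FROM   | left _ _ _ _  = eq FROM
        in-left e TO     | left _ _ _ _  = eq TO
        in-neither : frag P i ≢ frag P q → frag P i ≢ frag P p → ∀ f → μ f i ≡ new f i
        in-neither ne ne′ f with side p q P p≁q i
        ... | left e _ _ _  = contradiction e ne′
        ... | right e _ _ _ = contradiction e ne
        in-neither _ _ OUT    | other _ _ _ _ _  = eq OUT
        in-neither _ _ FRAG   | other _ _ f′ _ _ = trans (eq FRAG) (cong toℕ (sym f′))
        in-neither _ _ BEFORE | other _ _ _ b′ _ = trans (eq BEFORE) (sym b′)
        in-neither _ _ AFTER  | other _ _ _ _ a′ = trans (eq AFTER) (sym a′)
        in-neither _ _ FROM   | other _ _ _ _ _  = eq FROM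
        in-neither _ _ TO     | other _ _ _ _ _  = eq TO

  -- Of the registers, only the length of the chain and the flag outlive an iteration.
  Holds : ℕ → ℕ → Placement → (U V : ℕ → Fin n) → Registers → Memory → Set
  Holds k r P U V w μ = (∃[ y ] ∃[ v ] w ≡ y ∷ k ∷ r ∷ v) × (∀ f i → μ f i ≡ stored P U V f i)

  run-merge : ∀ {P F p q} U V → Layout P F → Valid P p q → ∀ {y k r a b} →
              Run mergeProgram (y ∷ k ∷ r ∷ toℕ (frag P q) ∷ toℕ p ∷ toℕ q ∷ a ∷ b ∷ []) (stored P U V)
                (Holds (k ∸ 2) r (merge p q P) U V)
  run-merge {P} {F} {p} {q} U V L valid {y} {k} {r} {a} {b} =
    run-←-seq END₁ (⊢cell FRAG (⊢$ BEST₁))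
    (run-mapped (run-turn U V L (after P p) (suc (suc (suc (suc (suc zero))))) refl (⊢cell AFTER (⊢$ BEST₁))) λ y₁ →
     run-mapped (run-turn U V L₁ (before P₁ q) (suc (suc zero)) (cong (λ f → toℕ (f q)) (sym frag₁)) (⊢cell BEFORE (⊢$ BEST₂))) λ y₂ →
     run-←-seq BEST₁ (⊢cell BEFORE (⊢$ BEST₁))
    (run-←-seq BEST₂ (⊢cell AFTER (⊢$ BEST₂))
    (run-←-seq SIZE (⊢monus (⊢$ SIZE) (⊢lit (s≤s (s≤s z≤n))))
    -- END₁ and HERE were read before the reversals, which change no names.
    (subst (λ f → Run concatenation (y₂ ∷ (k ∸ 2) ∷ r ∷ toℕ (f q) ∷ before P₂ p ∷ after P₂ q ∷ toℕ (f p) ∷ b ∷ [])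
                    (stored P₂ U V) (Holds (k ∸ 2) r (merge p q P) U V)) frag₂
      (run-weaken (run-concatenation U V L₂ (subst (λ f → f p ≢ f q) (sym frag₂) (proj₂ (proj₂ valid))))
        λ { ((y₃ , refl) , e) → (y₃ , _ , refl) , e })))))
    where
    P₁ = orientLast p P
    P₂ = orientFirst q P₁
    frag₁ : frag P₁ ≡ frag P
    frag₁ = frag-turn (after P p ℕ.≡ᵇ 0) (frag P p) P
    frag₂ : frag P₂ ≡ frag P
    frag₂ = frag-orient p q P
    L₁ : Layout P₁ F
    L₁ = turn-layout (after P p ℕ.≡ᵇ 0) (frag P p) L
    L₂ : Layout P₂ F
    L₂ = turn-layout (before P₁ q ℕ.≡ᵇ 0) (frag P₁ q) L₁

  run-push : ∀ {P p q} U V {k} → suc k < n → ∀ {y r h a b} →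
             Run pushProgram (y ∷ k ∷ r ∷ h ∷ toℕ p ∷ toℕ q ∷ a ∷ b ∷ []) (stored P U V)
               (Holds (suc k) r P (U [ suc k ≔ p ]) (V [ suc k ≔ q ]))
  run-push {P} {p} {q} U V {k} k<n {y} {r} {h} {a} {b} = run-←-seq SIZE (⊢add (⊢$ SIZE) (⊢lit (s≤s z≤n)) (≤-trans (≤-trans (≤-reflexive (+-comm k 1)) (<⇒≤ k<n)) (m≤m+n n n)))
    (run-store-seq FROM (⊢cast top≡ (⊢$ SIZE)) (⊢$ BEST₁)
    (run-store TO (⊢cast top≡ (⊢$ SIZE)) (⊢$ BEST₂)
    ((_ , _ , cong (λ z → y ∷ z ∷ r ∷ h ∷ toℕ p ∷ toℕ q ∷ a ∷ b ∷ []) (+-comm k 1)) , pushed)))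
    where
    top : Fin n
    top = fromℕ< k<n
    top≡ : k + 1 ≡ toℕ top
    top≡ = trans (+-comm k 1) (sym (toℕ-fromℕ< k<n))
    updated : ∀ (S : ℕ → Fin n) (z : Fin n) i → update (toℕ ∘ S ∘ toℕ) top (toℕ z) i ≡ toℕ ((S [ suc k ≔ z ]) (toℕ i))
    updated S z i = go (top ≟ i)
      where
      go : Dec (top ≡ i) → update (toℕ ∘ S ∘ toℕ) top (toℕ z) i ≡ toℕ ((S [ suc k ≔ z ]) (toℕ i))
      go (yes refl) = trans (update-same (toℕ ∘ S ∘ toℕ) top)
        (cong toℕ (sym (trans (cong (S [ suc k ≔ z ]) (toℕ-fromℕ< k<n)) (≔-same S (suc k)))))
      go (no ne) = trans (update-other (toℕ ∘ S ∘ toℕ) ne)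
        (cong toℕ (sym (≔-other S (λ e → ne (toℕ-injective (trans (toℕ-fromℕ< k<n) e))))))
    pushed : ∀ f i → put (put (stored P U V) FROM top (toℕ p)) TO top (toℕ q) f i ≡
                     stored P (U [ suc k ≔ p ]) (V [ suc k ≔ q ]) f i
    pushed OUT    i = refl
    pushed FRAG   i = refl
    pushed BEFORE i = refl
    pushed AFTER  i = refl
    pushed FROM   i = updated U p i
    pushed TO     i = updated V q i

  -- Zeroed memory already encodes the chain that consists of site 0 alone, and isolated sites have
  -- zero positions; only the names must be written.
  run-isolate : ∀ {y v} → Run isolate (y ∷ v) (λ _ _ → 0)
                  (Mapped v (stored isolated (λ _ → fromℕ< (ℕ.>-nonZero⁻¹ n)) (λ _ → fromℕ< (ℕ.>-nonZero⁻¹ n))))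
  run-isolate = run-map _ λ i {μ} eq → run-store FRAG (⊢$ SITE) (⊢$ SITE)
    (refl , stored-at i eq , λ f ne → put-other μ FRAG f ne)
    where
    stored-at : ∀ i {μ : Memory} → (∀ f → μ f i ≡ 0) → ∀ f → put μ FRAG i (toℕ i) f i ≡ stored isolated _ _ f i
    stored-at i eq OUT    = eq OUT
    stored-at i {μ} eq FRAG = update-same (μ FRAG) i
    stored-at i eq BEFORE = eq BEFORE
    stored-at i eq AFTER  = eq AFTER
    stored-at i eq FROM   = trans (eq FROM) (sym (toℕ-fromℕ< (ℕ.>-nonZero⁻¹ n)))
    stored-at i eq TO     = trans (eq TO) (sym (toℕ-fromℕ< (ℕ.>-nonZero⁻¹ n)))

  -- In a single fragment different sites have different positions, so no cell is overwritten.
  run-output : ∀ {P F} U V → Layout P F → ∀ {w} (t : Fin n → Fin n) → (∀ i → before P (t i) ≡ toℕ i) →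
               (∀ u v → frag P u ≡ frag P v) →
               Run output w (stored P U V) (λ _ μ → ∀ i → μ OUT i ≡ toℕ (t i))
  run-output {P} U V L {y ∷ v} t before-t single = run-for I step ((λ _ → refl) , λ _ ())
    λ { (_ , written) i → written (t i) (toℕ<n (t i)) i (sym (before-t i)) }
    where
    I : ℕ → Vec ℕ 7 → Memory → Set
    I j _ μ = (∀ i → μ BEFORE i ≡ before P i) × (∀ u → toℕ u < j → ∀ i → toℕ i ≡ before P u → μ OUT i ≡ toℕ u)

    step : ∀ i {v μ} → I (toℕ i) v μ → Run _ (toℕ i ∷ v) μ (λ w′ μ′ → ∃[ v′ ] w′ ≡ toℕ i ∷ v′ × I (suc (toℕ i)) v′ μ′)
    step i {v} {μ} (b , written) = run-store OUT (⊢cast (trans (b i) (sym pos≡)) (⊢cell BEFORE (⊢$ SITE))) (⊢$ SITE)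
      (v , refl , b , written′)
      where
      pos : Fin n
      pos = fromℕ< (before<n L i)
      pos≡ : toℕ pos ≡ before P i
      pos≡ = toℕ-fromℕ< (before<n L i)
      written′ : ∀ u → toℕ u < suc (toℕ i) → ∀ j → toℕ j ≡ before P u → update (μ OUT) pos (toℕ i) j ≡ toℕ u
      written′ u u≤i j e with m≤n⇒m<n∨m≡n (ℕ.≤-pred u≤i)
      ... | inj₂ u≡i = trans (cong (update (μ OUT) pos (toℕ i)) (sym pos≡j)) (trans (update-same (μ OUT) pos) (sym u≡i))
        where
        pos≡j : pos ≡ j
        pos≡j = toℕ-injective (trans pos≡ (trans (cong (before P) (sym (toℕ-injective u≡i))) (sym e)))
      ... | inj₁ u<i = trans (update-other (μ OUT) {pos} {j} λ { refl → ℕ.<-irrefl (cong toℕ (Layout.injective L (single u i) (trans (sym e) pos≡))) u<i })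
        (written u u<i j e)

  -- A push turns one unit of the budget m into an edge of the chain; a merge removes a fragment,
  -- worth 3, for one unit and at most two edges. The summand n keeps m positive, since k is less
  -- than n.
  Busy : ℕ → Registers → Memory → Set (c ⊔ ℓ₂)
  Busy m w μ = ∃[ P ] ∃[ F ] ∃[ k ] ∃[ U ] ∃[ V ]
    Invariant P F k U V × 3 * ∣ roots P ∣ + n ≤ m + k × Holds k 1 P U V w μ

  Finished : Registers → Memory → Set ℓ₂
  Finished w μ = ∃[ P ] ∃[ F ] ∃[ k ] ∃[ U ] ∃[ V ]
    Layout P F × Settled P F × (∀ u v → frag P u ≡ frag P v) × Holds k 0 P U V w μ

  run-iteration : ∀ {m w μ} → Busy (suc m) w μ → Run iteration w μ (λ w′ μ′ → Busy m w′ μ′ ⊎ Finished w′ μ′)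
  run-iteration {m} (P , F , k , U , V , I , m≥ , (y , c ∷ p₀ ∷ q₀ ∷ a₀ ∷ b₀ ∷ [] , refl) , μ≡) =
    run-resp μ≡
      (run-←-seq BEST₁ (⊢cast (cong (toℕ ∘ U) (sym k≡)) (⊢cell FROM (⊢cast k≡ (⊢$ SIZE))))
      (run-←-seq BEST₂ (⊢cast (cong (toℕ ∘ V) (sym k≡)) (⊢cell TO (⊢cast k≡ (⊢$ SIZE))))
      (run-←-seq HERE (⊢cell FRAG (⊢$ BEST₂))
      (run-seq (run-findEnd (suc (suc (suc (suc (suc zero))))) BEFORE {z = a} refl refl
        (λ i e z → injective (trans (toℕ-injective e) (sym a~)) (trans z (sym a-first))) (cong toℕ a~) a-first)
      λ { (refl , refl) →
      run-seq (run-findEnd (suc (suc (suc (suc (suc (suc zero)))))) AFTER {z = b} refl refl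
        (λ i e z → injective-after layout (trans (toℕ-injective e) (sym b~)) (trans z (sym b-last))) (cong toℕ b~) b-last)
      λ { (refl , refl) →
      run-seq (run-search P U V {k = k} layout a~ a-first b~ b-last)
      λ { (refl , p , q , refl , N) →
      run-if (⊢equal (⊢cell FRAG (⊢$ BEST₂)) (⊢$ HERE))
        (λ e → run-if (⊢equal (⊢cell FRAG (⊢$ BEST₁)) (⊢$ HERE))
          (λ e′ → run-← BUSY (⊢lit z≤n) (inj₂ (stopped N (toℕ-injective e) (toℕ-injective e′))))
          (λ ne → merged N (toℕ-injective e) (ne ∘ cong toℕ)))
        (λ ne → pushed N (ne ∘ cong toℕ)) }}}))))
    where
    open Invariant I
    open Layout layout
    a b : Fin n
    a = proj₁ (first layout (V k))
    b = proj₁ (last layout (V k))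
    a~ = proj₁ (proj₂ (first layout (V k)))
    b~ = proj₁ (proj₂ (last layout (V k)))
    a-first = proj₂ (proj₂ (first layout (V k)))
    b-last = proj₂ (proj₂ (last layout (V k)))
    κ : Fin n
    κ = fromℕ< (chain<n chain)
    k≡ : k ≡ toℕ κ
    k≡ = sym (toℕ-fromℕ< (chain<n chain))

    stopped : ∀ {p q} → Nearest P k U V p q → frag P q ≡ frag P (V k) → frag P p ≡ frag P (V k) →
              ∀ {v} → Finished (n ∷ k ∷ 0 ∷ v) (stored P U V)
    stopped N e e′ = P , F , k , U , V , layout , settled
      , (λ u v → trans (all u) (sym (all v))) , (n , _ , refl) , λ _ _ → refl
      where
      all : ∀ u → frag P u ≡ frag P (V k)
      all = invariant-stop I N (trans e′ (sym e))

    pushed : ∀ {p q} → Nearest P k U V p q → frag P q ≢ frag P (V k) →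
             Run pushProgram (n ∷ k ∷ 1 ∷ toℕ (frag P (V k)) ∷ toℕ p ∷ toℕ q ∷ toℕ a ∷ toℕ b ∷ []) (stored P U V)
               (λ w′ μ′ → Busy m w′ μ′ ⊎ Finished w′ μ′)
    pushed N ne = run-weaken (run-push U V (chain<n (Invariant.chain I′)))
      λ h → inj₁ (P , F , suc k , _ , _ , I′ , ≤-trans m≥ (≤-reflexive (sym (+-suc m k))) , h)
      where
      I′ = invariant-push I N ne

    merged : ∀ {p q} → Nearest P k U V p q → frag P q ≡ frag P (V k) → frag P p ≢ frag P (V k) →
             Run mergeProgram (n ∷ k ∷ 1 ∷ toℕ (frag P (V k)) ∷ toℕ p ∷ toℕ q ∷ toℕ a ∷ toℕ b ∷ []) (stored P U V)
               (λ w′ μ′ → Busy m w′ μ′ ⊎ Finished w′ μ′)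
    merged {p} {q} N e ne = subst (λ h → Run mergeProgram (n ∷ k ∷ 1 ∷ toℕ h ∷ toℕ p ∷ toℕ q ∷ toℕ a ∷ toℕ b ∷ [])
        (stored P U V) (λ w′ μ′ → Busy m w′ μ′ ⊎ Finished w′ μ′)) e
      (run-weaken (run-merge U V layout valid′)
        λ h → inj₁ (merge p q P , (p , q) ∷ F , k ∸ 2 , U , V , invariant-merge I N ne′ e , measure , h))
      where
      ne′ : frag P p ≢ frag P q
      ne′ f = ne (trans f e)
      valid′ : Valid P p q
      valid′ = merging-valid I N ne′ e
      measure : 3 * ∣ roots (merge p q P) ∣ + n ≤ m + (k ∸ 2)
      measure = +-cancelˡ-≤ 3 _ _ (begin
        3 + (3 * ∣ roots (merge p q P) ∣ + n)   ≡⟨ +-assoc 3 (3 * ∣ roots (merge p q P) ∣) n ⟨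
        3 + 3 * ∣ roots (merge p q P) ∣ + n     ≡⟨ cong (_+ n) (*-suc 3 ∣ roots (merge p q P) ∣) ⟨
        3 * suc ∣ roots (merge p q P) ∣ + n     ≤⟨ +-monoˡ-≤ n (*-monoʳ-≤ 3 (merge-roots layout valid′)) ⟩
        3 * ∣ roots P ∣ + n                     ≤⟨ m≥ ⟩
        suc m + k                               ≤⟨ +-monoʳ-≤ (suc m) (m≤n+m∸n k 2) ⟩
        suc m + (2 + (k ∸ 2))                   ≡⟨ +-assoc (suc m) 2 (k ∸ 2) ⟨
        suc m + 2 + (k ∸ 2)                     ≡⟨ cong (λ z → suc z + (k ∸ 2)) (+-comm m 2) ⟩
        3 + m + (k ∸ 2)                         ≡⟨ +-assoc 3 m (k ∸ 2) ⟩
        3 + (m + (k ∸ 2))                       ∎)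
        where open ≤-Reasoning

  run-multipleFragment : Run multipleFragment (replicate 8 0) (λ _ _ → 0)
    (λ _ μ → ∃[ t ] MultipleFragment D t × (∀ i → μ OUT i ≡ toℕ (t i)))
  run-multipleFragment = run-mapped run-isolate λ y →
    run-←-seq BUSY (⊢lit (s≤s z≤n))
    (run-seq (run-while I step (inj₁ (isolated , [] , 0 , _ , _ , initially _ , start , (y , _ , refl) , λ _ _ → refl)) ≤-refl)
    λ { (P , F , k , U , V , L , S , single , _ , μ≡) →
      let t , mf , before-t = outcome L single S
      in run-resp μ≡ (run-weaken (run-output U V L t before-t single) λ o → t , mf , o) })
    where
    I : ℕ → Registers → Memory → Set (c ⊔ ℓ₂)
    I m w μ = Busy m w μ ⊎ Finished w μ

    start : 3 * ∣ roots (isolated {n}) ∣ + n ≤ 4 * n + 0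
    start = begin
      3 * ∣ roots (isolated {n}) ∣ + n   ≤⟨ +-monoˡ-≤ n (*-monoʳ-≤ 3 (∣p∣≤n (roots (isolated {n})))) ⟩
      3 * n + n                    ≡⟨ +-comm (3 * n) n ⟩
      4 * n                        ≡⟨ +-identityʳ (4 * n) ⟨
      4 * n + 0                    ∎
      where open ≤-Reasoning

    step : ∀ {m w μ} → I m w μ → (Eval w μ ($ BUSY) 0 × Finished w μ) ⊎
           (∃[ m′ ] ∃[ a ] m ≡ suc m′ × Eval w μ ($ BUSY) (suc a) × Run iteration w μ (I m′))
    step (inj₂ f@(_ , _ , _ , _ , _ , _ , _ , _ , (_ , _ , refl) , _)) = inj₁ (⊢$ BUSY , f)
    step {suc m} (inj₁ b@(_ , _ , _ , _ , _ , _ , _ , (_ , _ , refl) , _)) = inj₂ (m , 0 , refl , ⊢$ BUSY , run-iteration b)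
    step {zero} (inj₁ (P , _ , k , _ , _ , i , m≥ , _)) =
      contradiction (≤-trans (m≤n+m n _) m≥) (<⇒≱ (chain<n (Invariant.chain i)))

  correct : Σ[ s ∈ State Distance ] ∃[ t ] ∃[ tour ]
    multipleFragment , initial ⇓[ t ] s × t ≤ bound n multipleFragment × Outputs s tour × MultipleFragment D tour
  correct = let s , t , _ , _ , ex , t≤ , R , tour , mf , out = Run.run run-multipleFragment started in
    s , t , tour , ex , t≤ , (λ i → trans (_≈⟨_,_⟩.cells R OUT i) (cong num (out i))) , mf
    where
    started : initial ≈⟨ replicate 8 0 , (λ _ _ → 0) ⟩
    started = record { sites = refl ; regs = λ x → cong num (sym (lookup-replicate x 0)) ; cells = λ _ _ → refl }

theorem4 : ∀ {c ℓ₁ ℓ₂} →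
    (Σ[ p ∈ Program ] Σ[ T ∈ (ℕ → ℕ) ] Σ[ S ∈ (ℕ → ℕ) ]
    ImplementsMultipleFragment c ℓ₁ ℓ₂ p T S
    × T ∈O (λ n → n ^ 2))
    × (Σ[ p ∈ Program ] Σ[ T ∈ (ℕ → ℕ) ] Σ[ S ∈ (ℕ → ℕ) ]
    ImplementsMultipleFragment c ℓ₁ ℓ₂ p T S
    × T ∈O (λ n → n ^ 2 * ⌊log₂ n ⌋ ^ 2)
    × S ∈O (λ n → n))
theorem4 {c} {ℓ₁} {ℓ₂} =
  (multipleFragment , T , S , implements , bound 1 multipleFragment , 1 , quadratic) ,
  (multipleFragment , T , S , implements , (bound 1 multipleFragment , 2 , quadratic-log) , (6 , 0 , λ _ _ → ≤-refl))
  where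
  T S : ℕ → ℕ
  T n = bound n multipleFragment
  S n = 6 * n

  implements : ImplementsMultipleFragment c ℓ₁ ℓ₂ multipleFragment T S
  implements = 4 , λ _ D → Correctness.correct D

  quadratic : ∀ n → 1 ≤ n → T n ≤ bound 1 multipleFragment * n ^ 2
  -- `depth multipleFragment` evaluates to 2: the loops over the sites inside the main loop.
  quadratic n 1≤n = bound-poly n {{ℕ.>-nonZero 1≤n}} multipleFragment

  -- From 2 on the logarithm is at least 1; at 1 it vanishes and the bound would fail.
  quadratic-log : ∀ n → 2 ≤ n → T n ≤ bound 1 multipleFragment * (n ^ 2 * ⌊log₂ n ⌋ ^ 2)
  quadratic-log n 2≤n = ≤-trans (quadratic n (≤-trans (s≤s z≤n) 2≤n)) (*-monoʳ-≤ (bound 1 multipleFragment)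
    (m≤m*n (n ^ 2) (⌊log₂ n ⌋ ^ 2) {{m^n≢0 ⌊log₂ n ⌋ 2 {{ℕ.>-nonZero (⌊log₂⌋-mono-≤ 2≤n)}}}}))
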